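{- Let $k\geq 3$ be an integer and let $G$ be a graph. Then there is some $C\in\mathbb{N}$ such that for all $n\in\mathbb{N}$ we have $M_{F^{(k)}(G)}(n)\leq C$.
   Context: A $k$-uniform hypergraph ($k$-graph) $H$ consists of a vertex set $V(H)$ and an edge set $E(H)\subseteq V(H)^{(k)}=\{S\subseteq V(H): |S|=k\}$. For $k$-graphs $F$ and $H$, a copy of $F$ in $H$ is a subhypergraph of $H$ isomorphic to $F$, and $c(F,H)$ denotes the number of copies of $F$ in $H$. For a $k$-graph $F$ and a $k$-graph $H$, the $F$-bootstrap percolation process ($F$-process) starting with $H$ is the sequence $(H_i)_{i\geq 0}$ of $k$-graphs on vertex set $V(H)$ defined by $H_0=H$ and $E(H_{i+1})=E(H_i)\cup\{e\in V(H)^{(k)}: c(F,H_i\cup e)>c(F,H_i)\}$, where $H_i\cup e$ is the $k$-graph $(V(H),E(H_i)\cup\{e\})$. The running time is $\tau_F(H)=\min\{t\in\mathbb{N}_{\geq 0}: H_t=H_{t+1}\}$, and $M_F(n)=\max\{\tau_F(H): H \text{ is a } k\text{ -graph with } n \text{ vertices}\}$. For a graph $G=(V,E)$ and an integer $k\ge 3$, the $k$-extension $F^{(k)}(G)$ is the $k$-graph with vertex set $V\,\dot\cup\,\{v_e^i: i\in[k-2], e\in E\}$ (all $v_e^i$ distinct new vertices) and edge set $\{e\cup\{v_e^1,\dots,v_e^{k-2}\}: e\in E\}$; i.e., each edge of $G$ is enlarged by its own $(k-2)$-set of new vertices. -}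

module Defs where

open import Data.Bool using (Bool; true; false; _∧_; _∨_; not; if_then_else_)
import Data.Bool.Properties as BoolP
open import Data.Nat using (ℕ; zero; suc; _+_; _*_; _∸_; _≤_; _<ᵇ_; _≡ᵇ_)
open import Data.Fin using (Fin)
import Data.Fin.Properties as FinP
open import Data.Fin.Subset using (Subset; ∣_∣; ⊤)
open import Data.List as List using (List; []; _∷_; filter; length; cartesianProduct; allFin)
open import Data.Vec as Vec using (Vec; []; _∷_; tabulate; lookup; zipWith; concat; replicate; _++_)
import Data.Vec.Properties as VecP
open import Data.Product using (_×_; _,_; Σ; ∃; ∃-syntax)
open import Relation.Nullary using (does)
open import Relation.Binary.PropositionalEquality using (_≡_)

allL : {A : Set} → (A → Bool) → List A → Bool
allL p = List.foldr (λ x b → p x ∧ b) true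

anyL : {A : Set} → (A → Bool) → List A → Bool
anyL p = List.foldr (λ x b → p x ∨ b) false

anyV : {m : ℕ} → Vec Bool m → Bool
anyV = Vec.foldr _ _∨_ false

_==F_ : {n : ℕ} → Fin n → Fin n → Bool
x ==F y = does (x FinP.≟ y)

_==S_ : {n : ℕ} → Subset n → Subset n → Bool
S ==S T = does (VecP.≡-dec BoolP._≟_ S T)

memS : {n : ℕ} → Subset n → List (Subset n) → Bool
memS S = anyL (λ T → S ==S T)

allSubsets : (n : ℕ) → List (Subset n)
allSubsets zero = [] ∷ []
allSubsets (suc n) =
  List.map (true ∷_) (allSubsets n) List.++ List.map (false ∷_) (allSubsets n)

allMaps : (m n : ℕ) → List (Vec (Fin n) m)
allMaps zero n = [] ∷ []
allMaps (suc m) n =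
  List.concatMap (λ x → List.map (x ∷_) (allMaps m n)) (allFin n)

-- all sublists of a list (the powerset, for a duplicate-free list)
sublists : {A : Set} → List A → List (List A)
sublists [] = [] ∷ []
sublists (x ∷ xs) = List.map (x ∷_) (sublists xs) List.++ sublists xs

record HG : Set where
  constructor hg
  field
    N : ℕ
    E : Subset N → Bool
open HG public

Uniform : ℕ → HG → Set
Uniform k H = ∀ S → E H S ≡ true → ∣ S ∣ ≡ k

edgeList : {n : ℕ} → (Subset n → Bool) → List (Subset n)
edgeList {n} E = filter (λ S → E S BoolP.≟ true) (allSubsets n)

image : {m n : ℕ} → Vec (Fin n) m → Subset m → Subset n
image φ S = tabulate (λ y → anyV (zipWith (λ b x → b ∧ (x ==F y)) S φ))

injectiveB : {m n : ℕ} → Vec (Fin n) m → Bool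
injectiveB {m} φ =
  allL (λ i → allL (λ j → (i ==F j) ∨ not (lookup φ i ==F lookup φ j)) (allFin m)) (allFin m)

-- (W , D) is a hypergraph on vertex set W ⊆ Fin n with edge list D;
-- isomorphic to F iff there is a bijection φ : V(F) → W with
-- S ∈ E(F) ⟺ φ(S) ∈ D for every S ⊆ V(F).
isoB : (F : HG) {n : ℕ} → Subset n → List (Subset n) → Bool
isoB F {n} W D =
  anyL (λ φ → injectiveB φ ∧ (image φ ⊤ ==S W)
              ∧ allL (λ S → not (E F S) ∨ memS (image φ S) D) (allSubsets (N F))
              ∧ allL (λ S → E F S ∨ not (memS (image φ S) D)) (allSubsets (N F)))
       (allMaps (N F) n)

-- (W , D) is a subhypergraph of H: D ⊆ E(H) (guaranteed by construction
-- below) and every edge of D lies inside W.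
insideB : {n : ℕ} → Subset n → List (Subset n) → Bool
insideB {n} W D = allL (λ e → allL (λ x → not (lookup e x) ∨ lookup W x) (allFin n)) D

-- c(F, H): the number of copies of F in H, i.e. of subhypergraphs
-- (W , D) of H (W ⊆ V(H), D ⊆ E(H), edges of D inside W) isomorphic to F.
copies : (F : HG) → {n : ℕ} → (Subset n → Bool) → ℕ
copies F {n} EH =
  length (filter (λ p → isCopyB (proj₁ p) (proj₂ p) BoolP.≟ true)
                 (cartesianProduct (allSubsets n) (sublists (edgeList EH))))
  where
  open import Data.Product using (proj₁; proj₂)
  isCopyB : Subset n → List (Subset n) → Bool
  isCopyB W D = insideB W D ∧ isoB F W D

addEdge : {n : ℕ} → (Subset n → Bool) → Subset n → (Subset n → Bool)
addEdge EH e S = EH S ∨ (S ==S e)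

step : (k : ℕ) (F : HG) {n : ℕ} → (Subset n → Bool) → (Subset n → Bool)
step k F EH S = EH S ∨ ((∣ S ∣ ≡ᵇ k) ∧ (copies F EH <ᵇ copies F (addEdge EH S)))

process : (k : ℕ) (F : HG) {n : ℕ} → (Subset n → Bool) → ℕ → (Subset n → Bool)
process k F EH zero = EH
process k F EH (suc t) = step k F (process k F EH t)

-- τ_F(H) ≤ C : there is t ≤ C with H_t = H_{t+1}
-- (equivalently: the minimum τ_F(H) exists and is at most C)
RunningTimeAtMost : (k : ℕ) (F : HG) (H : HG) → ℕ → Set
RunningTimeAtMost k F H C =
  ∃[ t ] (t ≤ C × (∀ S → process k F (E H) t S ≡ process k F (E H) (suc t) S))

Graph : Set
Graph = Σ HG (Uniform 2)

-- F^{(k)}(G): vertex set V(G) followed by m blocks of (k-2) new vertices,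
-- block j belonging to the j-th edge e_j of G; edges e_j ∪ block j.
extension : (k : ℕ) → HG → HG
extension k G = hg (N G + length es * (k ∸ 2)) edges
  where
  es = edgeList (E G)
  block : Fin (length es) → Vec Bool (length es * (k ∸ 2))
  block j = concat (tabulate (λ j' → replicate (k ∸ 2) (j' ==F j)))
  edges : Subset (N G + length es * (k ∸ 2)) → Bool
  edges S = anyL (λ j → S ==S (List.lookup es j ++ block j)) (allFin (length es))

{-# OPTIONS --safe #-}
module Submission where

open import Defs
open import Data.Nat using (ℕ; zero; suc; _+_; _*_; _∸_; _^_; _≤_; _<_; _≥_; z≤n; s≤s; _≤?_; _≡ᵇ_)
open import Data.Nat.Properties as ℕP using (≤-trans; ≤-refl; ≤-reflexive; +-comm; +-assoc; +-suc; +-mono-≤; ≤-pred)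
open import Data.Bool using (Bool; true; false; _∧_; _∨_; not)
import Data.Bool.Properties as BoolP
open import Data.Fin as Fin using (Fin; zero; suc; toℕ)
import Data.Fin.Properties as FinP
open import Data.Fin.Subset using (Subset; ∣_∣; ⊥; ⊤; inside; outside) renaming (_∈_ to _∈ₛ_; _∉_ to _∉ₛ_)
import Data.Fin.Subset.Properties as SubP
open import Data.List as List using (List; []; _∷_; _++_; length; filter; map; concat; tabulate; allFin; lookup; cartesianProduct; concatMap; take; reverse)
import Data.List.Properties as ListP
open import Data.List.Membership.Propositional using (_∈_; _∉_; find; lose)
import Data.List.Membership.Propositional.Properties as MemP
open import Data.List.Relation.Unary.Any as Any using (Any; here; there)
import Data.List.Relation.Unary.Any.Properties as AnyP
open import Data.List.Relation.Unary.All as All using (All; []; _∷_)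
import Data.List.Relation.Unary.All.Properties as AllP
open import Data.List.Relation.Unary.AllPairs as AllPairs using (AllPairs; []; _∷_)
import Data.List.Relation.Unary.AllPairs.Properties as AllPairsP
open import Data.List.Relation.Unary.Unique.Propositional using (Unique)
import Data.List.Relation.Unary.Unique.Propositional.Properties as UniqueP
open import Data.List.Relation.Binary.Sublist.Propositional using (_⊆_; []; _∷_; _∷ʳ_; ⊆-trans)
import Data.List.Relation.Binary.Sublist.Propositional.Properties as SublistP
open import Data.Vec as Vec using (Vec; []; _∷_)
import Data.Vec.Properties as VecP
import Data.Vec.Functional as Fun
import Data.Vec.Functional.Properties as FunP
open import Data.Product using (∃; ∃₂; ∃-syntax; _×_; _,_; proj₁; proj₂)
open import Data.Sum using (_⊎_; inj₁; inj₂; [_,_]′)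
import Data.Empty
open import Relation.Nullary using (¬_; Dec; yes; no; contradiction; does)
open import Relation.Nullary.Decidable using (¬?; _×-dec_; decidable-stable)
open import Relation.Unary using (Pred; Decidable)
open import Relation.Binary.Definitions using (tri<; tri≈; tri>)
open import Relation.Binary.PropositionalEquality using (_≡_; _≢_; refl; sym; trans; cong; cong₂; subst; subst₂; module ≡-Reasoning)
open import Function using (_∘_; id; flip; case_of_)
open import Function.Bundles using (Equivalence)
open import Level using (0ℓ)

-- The core of a copy of F is the image of V(G).  Every edge of G in the core of a newly completed copy becomes a
-- saturated pair within three steps: since each edge of F carries private vertices, which can be exchanged, all
-- k-sets through the pair that otherwise avoid the core get added.  Consider the cores of
-- the new edges in a long stretch of the process and pass to a sunflower of cores.  If an edge of G leaves the
-- kernel, its kernel end becomes a hub (a vertex in many saturated pairs); if an edge of G lies inside the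
-- petals, exchanging one vertex between two petals again gives new copies and thus a hub; otherwise the cores
-- have no unsaturated pair that was not already available after the first one, so nothing new could be added
-- later.  Hence each long stretch produces a new hub.  Boundedly many hubs suffice to add every k-set in four
-- more steps, because hubs provide private vertices (and core vertices) for arbitrary copies.

-- Two notions measure how freely a pair can be used. A saturated pair (`Sat`) has all `k`-sets
-- through it that otherwise avoid an exclusion list. An available pair (`Avail`) has, for every
-- small forbidden set, some edge that avoids it. If all pairs of a core are available, a copy can
-- be assembled greedily, and one more step saturates the core; saturation in turn gives
-- availability, since there are enough vertices to avoid any small set.
--
-- The obstacle is the exchange of a vertex between petals: the moved vertex and its free neighbours
-- lie in different petals, so saturation of the cores says nothing directly about these pairs. They
-- become available only through edges that contain a prescribed private vertex, and such reserved
-- vertices must not clash within one copy. A hub lifts this restriction, because it has too many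
-- leaves for a small set to block. But a hub works only away from its exclusion list. Hence petals
-- have to avoid all earlier hubs, and the hubs that finish the process together must not exclude
-- one another.

Injection : {A B : Set} → (A → B) → Set
Injection f = ∀ {i j} → f i ≡ f j → i ≡ j

stepwise-mono : {A : Set} (H : ℕ → A → Set) → (∀ t {f} → H t f → H (suc t) f) → ∀ {s t f} → s ≤ t → H s f → H t f
stepwise-mono H mono {s} {t} {f} s≤t Hs = subst (λ t → H t f) (ℕP.m∸n+n≡m s≤t) (go (t ∸ s))
  where
  go : ∀ d → H (d + s) f
  go zero = Hs
  go (suc d) = mono (d + s) (go d)

-- Ramsey-type and pigeonhole selection from lists

dichotomyLength : ℕ → ℕ → ℕ
dichotomyLength zero q = 0
dichotomyLength (suc r) q = suc (q + dichotomyLength r q)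

module _ {A : Set} where

  AllPairs-resp-⊆ : {R : A → A → Set} {xs ys : List A} → xs ⊆ ys → AllPairs R ys → AllPairs R xs
  AllPairs-resp-⊆ [] [] = []
  AllPairs-resp-⊆ (y ∷ʳ s) (r ∷ rs) = AllPairs-resp-⊆ s rs
  AllPairs-resp-⊆ (refl ∷ s) (r ∷ rs) = SublistP.All-resp-⊆ s r ∷ AllPairs-resp-⊆ s rs

  AllPairs-reverse : {R : A → A → Set} {xs : List A} → AllPairs R xs → AllPairs (flip R) (reverse xs)
  AllPairs-reverse [] = []
  AllPairs-reverse {R} {x ∷ xs} (r ∷ rs) = subst (AllPairs (flip R)) (sym (ListP.unfold-reverse x xs))
    (AllPairsP.++⁺ (AllPairs-reverse rs) ([] ∷ []) (All.tabulate λ z∈ → All.lookup r (AnyP.reverse⁻ z∈) ∷ []))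

  AllPairs-lookup : {R : A → A → Set} → (∀ {x y} → R x y → R y x) → {xs : List A} → AllPairs R xs →
    ∀ {i j} → i ≢ j → R (lookup xs i) (lookup xs j)
  AllPairs-lookup R-sym (r ∷ rs) {zero} {zero} i≢j = contradiction refl i≢j
  AllPairs-lookup R-sym (r ∷ rs) {zero} {suc j} i≢j = All.lookup r (MemP.∈-lookup j)
  AllPairs-lookup R-sym (r ∷ rs) {suc i} {zero} i≢j = R-sym (All.lookup r (MemP.∈-lookup i))
  AllPairs-lookup R-sym (r ∷ rs) {suc i} {suc j} i≢j = AllPairs-lookup R-sym rs (i≢j ∘ cong suc)

  AllPairs-lookup-< : {R : A → A → Set} → {xs : List A} → AllPairs R xs →
    ∀ {i j} → i Fin.< j → R (lookup xs i) (lookup xs j)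
  AllPairs-lookup-< (r ∷ rs) {zero} {suc j} _ = All.lookup r (MemP.∈-lookup j)
  AllPairs-lookup-< (r ∷ rs) {suc i} {suc j} (s≤s i<j) = AllPairs-lookup-< rs i<j

  AllPairs-× : {R S : A → A → Set} {xs : List A} → AllPairs R xs → AllPairs S xs →
    AllPairs (λ x y → R x y × S x y) xs
  AllPairs-× rs ss = AllPairs.zip (rs , ss)

  length-filter-split : {P : Pred A 0ℓ} (P? : Decidable P) (xs : List A) →
    length (filter P? xs) + length (filter (¬? ∘ P?) xs) ≡ length xs
  length-filter-split P? [] = refl
  length-filter-split P? (x ∷ xs) with P? x
  ... | yes _ = cong suc (length-filter-split P? xs)
  ... | no _ = trans (+-suc _ _) (cong suc (length-filter-split P? xs))

  filter-split-≥ : {P : Pred A 0ℓ} (P? : Decidable P) (xs : List A) {q r : ℕ} → q + r ≤ length xs →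
    q ≤ length (filter P? xs) ⊎ r ≤ length (filter (¬? ∘ P?) xs)
  filter-split-≥ P? xs {q} {r} le with q ≤? length (filter P? xs)
  ... | yes q≤ = inj₁ q≤
  ... | no q≰ = inj₂ (ℕP.+-cancelˡ-≤ q _ _ (≤-trans le (≤-trans (≤-reflexive (sym (length-filter-split P? xs)))
                  (ℕP.+-monoˡ-≤ _ (ℕP.<⇒≤ (ℕP.≰⇒> q≰))))))

  take-exactly : (q : ℕ) (xs : List A) → q ≤ length xs → ∃ λ ys → ys ⊆ xs × length ys ≡ q
  take-exactly q xs le = take q xs , SublistP.take-⊆ q xs , trans (ListP.length-take q xs) (ℕP.m≤n⇒m⊓n≡m le)

  -- Greedy choice: the head either has `q` later `R`-successors, or these are discarded and the
  -- head is kept. The sparse outcome controls `R x y` only for `x` before `y`, which matters when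
  -- `R` is not symmetric.
  dichotomy : {R : A → A → Set} (R? : ∀ x y → Dec (R x y)) (r q : ℕ) (xs : List A) →
    dichotomyLength r q ≤ length xs →
    (∃ λ ys → ys ⊆ xs × length ys ≡ r × AllPairs (λ x y → ¬ R x y) ys) ⊎
    (∃₂ λ x ys → x ∈ xs × ys ⊆ xs × length ys ≡ q × All (R x) ys)
  dichotomy R? zero q xs le = inj₁ ([] , SublistP.[]⊆-universal xs , refl , [])
  dichotomy R? (suc r) q (x ∷ xs) (s≤s le) with filter-split-≥ (R? x) xs le
  ... | inj₁ q≤ with take-exactly q (filter (R? x) xs) q≤
  ...   | ys , sub , len = inj₂ (x , ys , here refl , x ∷ʳ ⊆-trans sub (SublistP.filter-⊆ (R? x) xs) , len ,
            SublistP.All-resp-⊆ sub (AllP.all-filter (R? x) xs))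
  dichotomy R? (suc r) q (x ∷ xs) (s≤s le) | inj₂ r≤ with dichotomy R? r q (filter (¬? ∘ R? x) xs) r≤
  ... | inj₁ (ys , sub , len , ap) = inj₁ (x ∷ ys , refl ∷ ⊆-trans sub (SublistP.filter-⊆ (¬? ∘ R? x) xs) ,
            cong suc len , SublistP.All-resp-⊆ sub (AllP.all-filter (¬? ∘ R? x) xs) ∷ ap)
  ... | inj₂ (z , ys , z∈ , sub , len , al) = inj₂ (z , ys , there (proj₁ (MemP.∈-filter⁻ (¬? ∘ R? x) z∈)) ,
            x ∷ʳ ⊆-trans sub (SublistP.filter-⊆ (¬? ∘ R? x) xs) , len , al)

  -- Pigeonhole, peeling off one colour at a time. The extra one in the length keeps the list
  -- nonempty, so that running out of colours is contradictory.
  colour-class : {C : Set} {P : C → A → Set} (P? : ∀ c x → Dec (P c x)) (q : ℕ) (cs : List C) (xs : List A) →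
    All (λ x → Any (λ c → P c x) cs) xs → suc (length cs * q) ≤ length xs →
    ∃₂ λ c ys → c ∈ cs × ys ⊆ xs × length ys ≡ q × All (P c) ys
  colour-class P? q [] (x ∷ xs) (() ∷ _) le
  colour-class P? q (c ∷ cs) xs cov le with filter-split-≥ (P? c) xs {q} {suc (length cs * q)}
                                             (≤-trans (≤-reflexive (+-suc q _)) le)
  ... | inj₁ q≤ with take-exactly q (filter (P? c) xs) q≤
  ...   | ys , sub , len = c , ys , here refl , ⊆-trans sub (SublistP.filter-⊆ (P? c) xs) , len ,
            SublistP.All-resp-⊆ sub (AllP.all-filter (P? c) xs)
  colour-class P? q (c ∷ cs) xs cov le | inj₂ r≤
    with colour-class P? q cs (filter (¬? ∘ P? c) xs)
           (All.zipWith (λ { (here px , ¬px) → contradiction px ¬px ; (there a , _) → a })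
             (SublistP.All-resp-⊆ (SublistP.filter-⊆ (¬? ∘ P? c) xs) cov , AllP.all-filter (¬? ∘ P? c) xs)) r≤
  ... | d , ys , d∈ , sub , len , al = d , ys , there d∈ , ⊆-trans sub (SublistP.filter-⊆ (¬? ∘ P? c) xs) , len , al

  -- In a list whose members pairwise share no element of Z, every element of Z costs at most one member.
  remove-meeting : {Z : Set} {P : Z → A → Set} (P? : ∀ z x → Dec (P z x)) (q : ℕ) (zs : List Z) (xs : List A) →
    AllPairs (λ x y → ∀ z → ¬ (P z x × P z y)) xs → length zs + q ≤ length xs →
    ∃ λ ys → ys ⊆ xs × length ys ≡ q × All (λ y → All (λ z → ¬ P z y) zs) ys
  remove-meeting P? q [] xs ap le with take-exactly q xs le
  ... | ys , sub , len = ys , sub , len , All.tabulate (λ _ → [])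
  remove-meeting {P = P} P? q (z ∷ zs) xs ap le
    with remove-meeting P? q zs (filter (¬? ∘ P? z) xs) (AllPairsP.filter⁺ (¬? ∘ P? z) ap) (≤-pred (≤-trans le (atMostOne xs ap)))
    where
    atMostOne : ∀ xs → AllPairs (λ x y → ∀ z → ¬ (P z x × P z y)) xs → length xs ≤ suc (length (filter (¬? ∘ P? z) xs))
    atMostOne [] _ = z≤n
    atMostOne (x ∷ xs) (r ∷ rs) with P? z x
    ... | no _ = s≤s (atMostOne xs rs)
    ... | yes pzx = s≤s (≤-reflexive (cong length (sym (ListP.filter-all (¬? ∘ P? z) (All.map (λ h pzy → h z (pzx , pzy)) r)))))
  ... | ys , sub , len , al = ys , ⊆-trans sub (SublistP.filter-⊆ (¬? ∘ P? z) xs) , len ,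
        All.zipWith (λ (p , ps) → p ∷ ps) (SublistP.All-resp-⊆ sub (AllP.all-filter (¬? ∘ P? z) xs) , al)

-- Sunflowers of labelled cores

length-cartesianProduct : {A B : Set} (xs : List A) (ys : List B) → length (cartesianProduct xs ys) ≡ length xs * length ys
length-cartesianProduct [] ys = refl
length-cartesianProduct (x ∷ xs) ys = trans (ListP.length-++ (map (x ,_) ys))
  (cong₂ _+_ (ListP.length-map (x ,_) ys) (length-cartesianProduct xs ys))

-- The argument `d` bounds the number of positions not yet constant, so `suc d * suc d` bounds the
-- pairs of positions at which two members can coincide; the outer `suc` is the one asked for by
-- `colour-class`.
sunflowerLength : ℕ → ℕ → ℕ
sunflowerLength zero q = q
sunflowerLength (suc d) q = dichotomyLength q (suc (suc d * suc d * sunflowerLength d q))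

module Sunflower {I : Set} {n p : ℕ} (φ : I → Fin p → Fin n) where

  sharePair : Fin p × Fin p → I → I → Set
  sharePair (v , w) i j = φ i v ≡ φ j w

  Shares : List (Fin p) → I → I → Set
  Shares free i j = Any (λ vw → sharePair vw i j) (cartesianProduct free free)

  shares? : ∀ free i j → Dec (Shares free i j)
  shares? free i j = Any.any? (λ vw → φ i (proj₁ vw) FinP.≟ φ j (proj₂ vw)) (cartesianProduct free free)

  Constant : List (Fin p) → List I → Set
  Constant free xs = ∀ v → v ∉ free → ∀ {i j} → i ∈ xs → j ∈ xs → φ i v ≡ φ j v

  -- Induction on the number of free positions. If one member `x` shares vertices with many others,
  -- then many of these do so at the same pair `(v , w)`. On them position `w` has the constant
  -- value `φ x v`, so `w` leaves `free`.
  sunflower : ∀ d q (free : List (Fin p)) (xs : List I) → length free ≤ d → sunflowerLength d q ≤ length xs →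
    Constant free xs →
    ∃₂ λ free′ ys → ys ⊆ xs × length ys ≡ q × Constant free′ ys × AllPairs (λ i j → ¬ Shares free′ i j) ys
  sunflower zero q [] xs z≤n le const with take-exactly q xs le
  ... | ys , sub , len = [] , ys , sub , len ,
        (λ v v∉ i∈ j∈ → const v v∉ (SublistP.Any-resp-⊆ sub i∈) (SublistP.Any-resp-⊆ sub j∈)) , noShares ys
    where
    noShares : ∀ ys → AllPairs (λ i j → ¬ Shares [] i j) ys
    noShares [] = []
    noShares (y ∷ ys) = All.tabulate (λ _ → λ { () }) ∷ noShares ys
  sunflower (suc d) q free xs len≤ le const
    with dichotomy (shares? free) q (suc (suc d * suc d * sunflowerLength d q)) xs le
  ... | inj₁ (ys , sub , len , ap) = free , ys , sub , len ,
        (λ v v∉ i∈ j∈ → const v v∉ (SublistP.Any-resp-⊆ sub i∈) (SublistP.Any-resp-⊆ sub j∈)) , ap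
  ... | inj₂ (x , ys , x∈ , sub , len , al)
    with colour-class {P = λ vw → sharePair vw x} (λ vw j → φ x (proj₁ vw) FinP.≟ φ j (proj₂ vw)) (sunflowerLength d q)
           (cartesianProduct free free) ys al
           (≤-trans (s≤s (ℕP.*-monoˡ-≤ (sunflowerLength d q)
              (≤-trans (≤-reflexive (length-cartesianProduct free free)) (ℕP.*-mono-≤ len≤ len≤)))) (≤-reflexive (sym len)))
  ... | (v , w) , zs , vw∈ , sub′ , len′ , al′
    with sunflower d q (filter (¬? ∘ (w FinP.≟_)) free) zs
           (≤-pred (≤-trans (ListP.filter-notAll (¬? ∘ (w FinP.≟_)) free
              (Any.map (λ w≡ ¬w≡ → ¬w≡ w≡) (proj₂ (MemP.∈-cartesianProduct⁻ free free vw∈)))) len≤))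
           (≤-reflexive (sym len′)) const′
    where
    const′ : Constant (filter (¬? ∘ (w FinP.≟_)) free) zs
    const′ u u∉ i∈ j∈ with w FinP.≟ u
    ... | yes refl = trans (sym (All.lookup al′ i∈)) (All.lookup al′ j∈)
    ... | no w≢u = const u (λ u∈ → u∉ (MemP.∈-filter⁺ (¬? ∘ (w FinP.≟_)) u∈ w≢u))
                     (SublistP.Any-resp-⊆ (⊆-trans sub′ sub) i∈) (SublistP.Any-resp-⊆ (⊆-trans sub′ sub) j∈)
  ... | free′ , us , sub″ , rest = free′ , us , ⊆-trans sub″ (⊆-trans sub′ sub) , rest

module _ {n p L : ℕ} (φ : Fin L → Fin p → Fin n) where

  open Sunflower φ

  -- An element of `Z` lies in at most one petal, so `z` surplus members pay for avoiding `Z`.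
  -- Selection by sublists makes `ρ` increasing; this order later becomes the order in time.
  petals : ∀ q (Z : List (Fin n)) {z} → length Z ≤ z → sunflowerLength p (z + q) ≤ L →
    ∃₂ λ (free : List (Fin p)) (ρ : Fin q → Fin L) →
      (∀ {v} → v ∉ free → ∀ i j → φ (ρ i) v ≡ φ (ρ j) v) ×
      (∀ {i j v w} → i ≢ j → v ∈ free → w ∈ free → φ (ρ i) v ≢ φ (ρ j) w) ×
      (∀ i {v} → v ∈ free → φ (ρ i) v ∉ Z) ×
      (∀ {i j} → i Fin.< j → ρ i Fin.< ρ j)
  petals q Z {z} Z≤ L≥
    with sunflower p (z + q) (allFin p) (allFin L) (≤-reflexive (ListP.length-tabulate {n = p} id))
           (≤-trans L≥ (≤-reflexive (sym (ListP.length-tabulate {n = L} id)))) (λ v v∉ → contradiction (MemP.∈-allFin v) v∉)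
  ... | free , ys , sub , len , const , ap
    with remove-meeting {P = λ z i → Any (λ v → φ i v ≡ z) free} (λ z i → Any.any? (λ v → φ i v FinP.≟ z) free) q Z ys
           (AllPairs.map (λ ¬shares z (i∋z , j∋z) → ¬shares (shares i∋z j∋z)) ap)
           (≤-trans (ℕP.+-monoˡ-≤ q Z≤) (≤-reflexive (sym len)))
    where
    shares : ∀ {i j z} → Any (λ v → φ i v ≡ z) free → Any (λ v → φ j v ≡ z) free → Shares free i j
    shares i∋z j∋z with find i∋z | find j∋z
    ... | v , v∈ , e | w , w∈ , e′ = lose (MemP.∈-cartesianProduct⁺ v∈ w∈) (trans e (sym e′))
  ... | zs , sub′ , refl , avoid = free , lookup zs ,
        (λ v∉ i j → const _ v∉ (SublistP.Any-resp-⊆ sub′ (MemP.∈-lookup i)) (SublistP.Any-resp-⊆ sub′ (MemP.∈-lookup j))) ,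
        (λ i≢j v∈ w∈ e → AllPairs-lookup {R = λ i j → ∀ v w → v ∈ free → w ∈ free → φ i v ≢ φ j w}
            (λ r v w v∈ w∈ e → r w v w∈ v∈ (sym e))
            (AllPairs.map (λ ¬shares v w v∈ w∈ e → ¬shares (lose (MemP.∈-cartesianProduct⁺ v∈ w∈) e)) (AllPairs-resp-⊆ sub′ ap))
            i≢j _ _ v∈ w∈ e) ,
        (λ i v∈ z∈ → All.lookup (All.lookup avoid (MemP.∈-lookup i)) z∈ (lose v∈ refl)) ,
        AllPairs-lookup-< (AllPairs-resp-⊆ (⊆-trans sub′ sub) (AllPairsP.tabulate⁺-< id))

-- Fresh vertices and subsets of prescribed size

length-concat-tabulate : {A : Set} (m : ℕ) (f : Fin m → List A) {k : ℕ} → (∀ i → length (f i) ≤ k) →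
  length (concat (tabulate f)) ≤ m * k
length-concat-tabulate zero f le = z≤n
length-concat-tabulate (suc m) f le = ≤-trans (≤-reflexive (ListP.length-++ (f zero)))
  (+-mono-≤ (le zero) (length-concat-tabulate m (f ∘ suc) (le ∘ suc)))

∈-concat-tabulate : {A : Set} {m : ℕ} (f : Fin m → List A) {z : A} (i : Fin m) → z ∈ f i → z ∈ concat (tabulate f)
∈-concat-tabulate f i z∈ = MemP.∈-concat⁺′ z∈ (MemP.∈-tabulate⁺ i)

∈-concat-tabulate⁻ : {A : Set} {m : ℕ} (f : Fin m → List A) {z : A} → z ∈ concat (tabulate f) → ∃ λ i → z ∈ f i
∈-concat-tabulate⁻ f z∈ with MemP.∈-concat⁻′ _ z∈
... | xs , z∈xs , xs∈ with MemP.∈-tabulate⁻ {f = f} xs∈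
... | i , refl = i , z∈xs

module _ {n : ℕ} where

  open import Data.List.Membership.DecPropositional (FinP._≟_ {n}) public using (_∈?_)

  escape : {q : ℕ} (g : Fin q → Fin n) → Injection g → (A : List (Fin n)) → length A < q → ∃ λ i → g i ∉ A
  escape {q} g g-inj A lt with FinP.any? (λ i → ¬? (g i ∈? A))
  ... | yes found = found
  ... | no none = contradiction (FinP.injective⇒≤ {f = index} index-inj) (ℕP.<⇒≱ lt)
    where
    mem : ∀ i → g i ∈ A
    mem i = decidable-stable (g i ∈? A) λ ∉A → none (i , ∉A)
    index : Fin q → Fin (length A)
    index i = Any.index (mem i)
    index-inj : Injection index
    index-inj {i} {j} eq = g-inj (trans (AnyP.lookup-index (mem i))
      (trans (cong (lookup A) eq) (sym (AnyP.lookup-index (mem j)))))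

  fresh : (A : List (Fin n)) → length A < n → ∃ λ z → z ∉ A
  fresh A lt = escape id id A lt

  freshFamily : (q : ℕ) (A : List (Fin n)) → q + length A ≤ n → ∃ λ (g : Fin q → Fin n) → Injection g × (∀ i → g i ∉ A)
  freshFamily zero A le = (λ ()) , (λ { {()} }) , λ ()
  freshFamily (suc q) A le with fresh A (≤-trans (s≤s (ℕP.m≤n+m _ q)) le)
  ... | z , z∉ with freshFamily q (z ∷ A) (≤-trans (≤-reflexive (+-suc q _)) le)
  ... | g , g-inj , g∉ = g′ , inj , out
    where
    g′ : Fin (suc q) → Fin n
    g′ zero = z
    g′ (suc i) = g i
    inj : Injection g′
    inj {zero} {zero} _ = refl
    inj {zero} {suc j} eq = contradiction (here (sym eq)) (g∉ j)
    inj {suc i} {zero} eq = contradiction (here eq) (g∉ i)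
    inj {suc i} {suc j} eq = cong suc (g-inj eq)
    out : ∀ i → g′ i ∉ A
    out zero = z∉
    out (suc i) z∈ = g∉ i (there z∈)

elems : {n : ℕ} → Subset n → List (Fin n)
elems [] = []
elems (true ∷ f) = zero ∷ map suc (elems f)
elems (false ∷ f) = map suc (elems f)

length-elems : {n : ℕ} (f : Subset n) → length (elems f) ≡ ∣ f ∣
length-elems [] = refl
length-elems (true ∷ f) = cong suc (trans (ListP.length-map suc (elems f)) (length-elems f))
length-elems (false ∷ f) = trans (ListP.length-map suc (elems f)) (length-elems f)

∈-elems⁺ : {n : ℕ} {f : Subset n} {z : Fin n} → z ∈ₛ f → z ∈ elems f
∈-elems⁺ {f = true ∷ f} {zero} _ = here refl
∈-elems⁺ {f = true ∷ f} {suc z} (Vec.there z∈) = there (MemP.∈-map⁺ suc (∈-elems⁺ z∈))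
∈-elems⁺ {f = false ∷ f} {suc z} (Vec.there z∈) = MemP.∈-map⁺ suc (∈-elems⁺ z∈)

∈-elems⁻ : {n : ℕ} {f : Subset n} {z : Fin n} → z ∈ elems f → z ∈ₛ f
∈-elems⁻ {f = true ∷ f} (here refl) = Vec.here
∈-elems⁻ {f = true ∷ f} (there z∈) with MemP.∈-map⁻ suc z∈
... | _ , w∈ , refl = Vec.there (∈-elems⁻ w∈)
∈-elems⁻ {f = false ∷ f} z∈ with MemP.∈-map⁻ suc z∈
... | _ , w∈ , refl = Vec.there (∈-elems⁻ w∈)

elems-unique : {n : ℕ} (f : Subset n) → Unique (elems f)
elems-unique [] = []
elems-unique (true ∷ f) = AllP.map⁺ (All.tabulate λ _ ()) ∷ UniqueP.map⁺ FinP.suc-injective (elems-unique f)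
elems-unique (false ∷ f) = UniqueP.map⁺ FinP.suc-injective (elems-unique f)

lookup-injective : {A : Set} {xs : List A} → Unique xs → Injection (lookup xs)
lookup-injective {xs = xs} u {i} {j} eq with i FinP.≟ j
... | yes i≡j = i≡j
... | no i≢j = contradiction eq (AllPairs-lookup (λ x≢y → x≢y ∘ sym) u i≢j)

module _ {n : ℕ} where

  pick : (f : Subset n) (A : List (Fin n)) → length A < ∣ f ∣ → ∃ λ z → z ∈ₛ f × z ∉ A
  pick f A lt with escape (lookup (elems f)) (lookup-injective (elems-unique f)) A (subst (length A <_) (sym (length-elems f)) lt)
  ... | i , ∉A = lookup (elems f) i , ∈-elems⁻ (MemP.∈-lookup i) , ∉A

insert : {n : ℕ} → Fin n → Subset n → Subset n
insert z f = f Vec.[ z ]≔ inside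

∣insert∣ : {n : ℕ} (z : Fin n) (f : Subset n) → z ∉ₛ f → ∣ insert z f ∣ ≡ suc ∣ f ∣
∣insert∣ zero (true ∷ f) z∉ = contradiction Vec.here z∉
∣insert∣ zero (false ∷ f) z∉ = refl
∣insert∣ (suc z) (true ∷ f) z∉ = cong suc (∣insert∣ z f (z∉ ∘ Vec.there))
∣insert∣ (suc z) (false ∷ f) z∉ = ∣insert∣ z f (z∉ ∘ Vec.there)

∈-insert⁻ : {n : ℕ} {z w : Fin n} {f : Subset n} → w ∈ₛ insert z f → w ≡ z ⊎ w ∈ₛ f
∈-insert⁻ {z = z} {w} {f} w∈ with w FinP.≟ z
... | yes w≡z = inj₁ w≡z
... | no w≢z = inj₂ (VecP.lookup⇒[]= w f (trans (sym (VecP.lookup∘updateAt′ w z w≢z f)) (VecP.[]=⇒lookup w∈)))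

∈-insert-here : {n : ℕ} (z : Fin n) (f : Subset n) → z ∈ₛ insert z f
∈-insert-here z f = VecP.lookup⇒[]= z _ (VecP.lookup∘updateAt z f)

∈-insert-there : {n : ℕ} {z w : Fin n} {f : Subset n} → w ∈ₛ f → w ∈ₛ insert z f
∈-insert-there {z = z} {w} {f} w∈ with w FinP.≟ z
... | yes refl = ∈-insert-here z f
... | no w≢z = VecP.lookup⇒[]= w _ (trans (VecP.lookup∘updateAt′ w z w≢z f) (VecP.[]=⇒lookup w∈))

fromList : {n : ℕ} → List (Fin n) → Subset n
fromList = List.foldr insert ⊥

∈-fromList⁻ : {n : ℕ} (l : List (Fin n)) {z : Fin n} → z ∈ₛ fromList l → z ∈ l
∈-fromList⁻ [] z∈ = contradiction z∈ SubP.∉⊥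
∈-fromList⁻ (x ∷ l) z∈ with ∈-insert⁻ z∈
... | inj₁ z≡x = here z≡x
... | inj₂ z∈l = there (∈-fromList⁻ l z∈l)

∈-fromList⁺ : {n : ℕ} {l : List (Fin n)} {z : Fin n} → z ∈ l → z ∈ₛ fromList l
∈-fromList⁺ {l = x ∷ l} (here refl) = ∈-insert-here x _
∈-fromList⁺ {l = x ∷ l} (there z∈) = ∈-insert-there (∈-fromList⁺ z∈)

∣fromList∣ : {n : ℕ} {l : List (Fin n)} → Unique l → ∣ fromList l ∣ ≡ length l
∣fromList∣ {n} [] = SubP.∣⊥∣≡0 n
∣fromList∣ {l = x ∷ l} (x∉ ∷ u) = trans (∣insert∣ x _ (λ x∈ → All.lookup x∉ (∈-fromList⁻ l x∈) refl)) (cong suc (∣fromList∣ u))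

fillSet : {n : ℕ} (k : ℕ) (l A : List (Fin n)) → Unique l → length l ≤ k → k + length A ≤ n →
  ∃ λ (f : Subset n) → ∣ f ∣ ≡ k × (∀ {z} → z ∈ l → z ∈ₛ f) × (∀ {z} → z ∈ₛ f → z ∈ l ⊎ z ∉ A)
fillSet {n} k l A u len≤ le = subst (λ k → ∃ λ (f : Subset n) → ∣ f ∣ ≡ k × _) (ℕP.m∸n+n≡m len≤)
  (grow (k ∸ length l) (≤-trans (≤-reflexive (cong (_+ length A) (ℕP.m∸n+n≡m len≤))) le))
  where
  grow : ∀ r → r + length l + length A ≤ n →
    ∃ λ (f : Subset n) → ∣ f ∣ ≡ r + length l × (∀ {z} → z ∈ l → z ∈ₛ f) × (∀ {z} → z ∈ₛ f → z ∈ l ⊎ z ∉ A)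
  grow zero _ = fromList l , ∣fromList∣ u , ∈-fromList⁺ , inj₁ ∘ ∈-fromList⁻ l
  grow (suc r) bd with grow r (ℕP.<⇒≤ bd)
  ... | f , size , has , out
    with fresh (elems f ++ A) (≤-trans (≤-reflexive (cong suc (trans (ListP.length-++ (elems f)) (cong (_+ length A) (trans (length-elems f) size))))) bd)
  ... | z , z∉ = insert z f , trans (∣insert∣ z f (z∉ ∘ MemP.∈-++⁺ˡ ∘ ∈-elems⁺)) (cong suc size) , ∈-insert-there ∘ has ,
        λ w∈ → case ∈-insert⁻ w∈ of λ { (inj₁ refl) → inj₂ (z∉ ∘ MemP.∈-++⁺ʳ (elems f)) ; (inj₂ w∈f) → out w∈f }

-- The constants

module Constants (k p m : ℕ) where

  opaque
    robustness hubDegree hubSize spareHubs exclusion hubCount epochEvents epochLength runningTime minVertices : ℕ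
    -- All that an edge of a copy under construction may have to avoid: the core, the target
    -- `k`-set, and `k` vertices for each edge of `G`, whether already chosen or only reserved.
    robustness = (p + k) + m * k
    -- One leaf must remain after removing the centre, the vertex to be joined to it, and a
    -- forbidden set.
    hubDegree = 3 + robustness
    -- The cores of all petals of one sunflower together.
    hubSize = suc hubDegree * p
    -- Enough hubs to find one outside two vertices and a forbidden set, and enough to fill a whole
    -- core besides one given hub.
    spareHubs = 2 + robustness + p
    -- Covers every kind of exclusion list: that of a single hub, that of a pool of hubs with their
    -- centres, and the vertices of one copy.
    exclusion = hubSize + suc spareHubs * suc hubSize + (p + m * k)
    -- One selection for each direction in which a hub can exclude the centre of another.
    hubCount = dichotomyLength (dichotomyLength (suc spareHubs) (suc hubSize)) (suc hubSize)
    -- Besides the petals wanted, one surplus petal for each centre and each excluded vertex of up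
    -- to `hubCount` earlier hubs.
    epochEvents = sunflowerLength p (hubCount * suc hubSize + suc hubDegree)
    -- New edges are sampled every fourth step: three steps saturate a core, and the fourth turns
    -- pairs that are robust by then into the saturation of a later core. The final step makes the
    -- new hub live.
    epochLength = suc (4 * epochEvents)
    runningTime = 4 + hubCount * epochLength
    -- Room for a `k`-set that avoids both a forbidden set and an exclusion list.
    minVertices = k + (robustness + exclusion)

    robustness≥ : (p + k) + m * k ≤ robustness
    robustness≥ = ≤-refl

    hubDegree≥ : 3 + robustness ≤ hubDegree
    hubDegree≥ = ≤-refl

    hubSize≥ : suc hubDegree * p ≤ hubSize
    hubSize≥ = ≤-refl

    spareHubs≥robustness : 2 + robustness ≤ spareHubs
    spareHubs≥robustness = ℕP.m≤m+n (2 + robustness) p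

    spareHubs≥p : p ≤ spareHubs
    spareHubs≥p = ℕP.m≤n+m p (2 + robustness)

    exclusion≥hub : hubSize ≤ exclusion
    exclusion≥hub = ≤-trans (ℕP.m≤m+n hubSize (suc spareHubs * suc hubSize)) (ℕP.m≤m+n _ (p + m * k))

    exclusion≥pool : suc spareHubs * suc hubSize ≤ exclusion
    exclusion≥pool = ≤-trans (ℕP.m≤n+m _ hubSize) (ℕP.m≤m+n _ (p + m * k))

    exclusion≥copy : p + m * k ≤ exclusion
    exclusion≥copy = ℕP.m≤n+m (p + m * k) (hubSize + suc spareHubs * suc hubSize)

    hubCount≥ : dichotomyLength (dichotomyLength (suc spareHubs) (suc hubSize)) (suc hubSize) ≤ hubCount
    hubCount≥ = ≤-refl

    epochEvents≥ : sunflowerLength p (hubCount * suc hubSize + suc hubDegree) ≤ epochEvents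
    epochEvents≥ = ≤-refl

    epochLength≡ : epochLength ≡ suc (4 * epochEvents)
    epochLength≡ = refl

    runningTime≡ : runningTime ≡ 4 + hubCount * epochLength
    runningTime≡ = refl

    minVertices≥ : k + (robustness + exclusion) ≤ minVertices
    minVertices≥ = ≤-refl

  poolSize : ℕ
  poolSize = suc spareHubs

-- Copies and the abstract process

-- Private vertices are not named: by `core`, `meet` and `size` the part of each edge beyond its two
-- core vertices is a set of `k - 2` vertices belonging to that edge alone, and their order is
-- irrelevant.
record IsCopy (k : ℕ) {n p m : ℕ} (a b : Fin m → Fin p) (c : Fin p → Fin n) (h : Fin m → Subset n) : Set where
  field
    inj   : Injection c
    left  : ∀ j → c (a j) ∈ₛ h j
    right : ∀ j → c (b j) ∈ₛ h j
    core  : ∀ j v → c v ∈ₛ h j → v ≡ a j ⊎ v ≡ b j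
    meet  : ∀ {i j z} → i ≢ j → z ∈ₛ h i → z ∈ₛ h j → ∃ λ v → z ≡ c v
    size  : ∀ j → ∣ h j ∣ ≡ k

Joins : {p m : ℕ} (a b : Fin m → Fin p) → Fin m → Fin p → Fin p → Set
Joins a b j v w = (a j ≡ v × b j ≡ w) ⊎ (b j ≡ v × a j ≡ w)

record NewEdge (k : ℕ) {n p m : ℕ} (a b : Fin m → Fin p) (H : ℕ → Subset n → Set) (t : ℕ) : Set where
  field
    vertex : Fin p → Fin n
    edge   : Fin m → Subset n
    isCopy : IsCopy k a b vertex edge
    label  : Fin m
    absent : ¬ H t (edge label)
    built  : ∀ j → H (suc t) (edge j)

-- The process enters only as a growing family `H` that contains, one step later, any edge
-- completing a copy. The converse, that every added set comes from a copy, enters through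
-- `NewEdge`.
module Combinatorics {n k p m : ℕ} (a b : Fin m → Fin p)
  (a≢b : ∀ j → a j ≢ b j)
  (simple : ∀ {i j v w} → Joins a b i v w → Joins a b j v w → i ≡ j)
  (3≤k : 3 ≤ k)
  (H : ℕ → Subset n → Set)
  (mono : ∀ {t f} → H t f → H (suc t) f)
  (complete : ∀ {t c h} j → IsCopy k a b c h → (∀ i → i ≢ j → H t (h i)) → H (suc t) (h j))
  (large : Constants.minVertices k p m ≤ n)
  where

  open Constants k p m

  mono-≤ : ∀ {s t f} → s ≤ t → H s f → H t f
  mono-≤ = stepwise-mono H (λ t → mono {t})

  -- Saturated and available pairs

  Sat : ℕ → Fin n → Fin n → List (Fin n) → Set
  Sat t x y B = ∀ {f} → ∣ f ∣ ≡ k → x ∈ₛ f → y ∈ₛ f → (∀ {z} → z ∈ₛ f → z ≡ x ⊎ z ≡ y ⊎ z ∉ B) → H t f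

  Avoiding : Fin n → Fin n → List (Fin n) → Subset n → Set
  Avoiding x y A h = ∣ h ∣ ≡ k × x ∈ₛ h × y ∈ₛ h × (∀ {z} → z ∈ₛ h → z ≡ x ⊎ z ≡ y ⊎ z ∉ A)

  -- The list `r` holds private vertices that the edge may be forced to use, so only sets `A`
  -- disjoint from `r` are required to be avoidable. With `r` empty the pair withstands every small
  -- `A`.
  Avail : ℕ → Fin n → Fin n → List (Fin n) → Set
  Avail t x y r = ∀ A → length A ≤ robustness → (∀ {z} → z ∈ r → z ∉ A) → ∃ λ h → H t h × Avoiding x y A h

  Rob : ℕ → Fin n → Fin n → Set
  Rob t x y = Avail t x y []

  Avail-sym : ∀ {t x y r} → Avail t x y r → Avail t y x r
  Avail-sym av A le dis with av A le dis
  ... | h , Hh , size , x∈ , y∈ , out = h , Hh , size , y∈ , x∈ ,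
    λ z∈ → case out z∈ of λ { (inj₁ e) → inj₂ (inj₁ e) ; (inj₂ (inj₁ e)) → inj₁ e ; (inj₂ (inj₂ e)) → inj₂ (inj₂ e) }

  Sat-sym : ∀ {t x y B} → Sat t x y B → Sat t y x B
  Sat-sym sat size y∈ x∈ out = sat size x∈ y∈
    λ z∈ → case out z∈ of λ { (inj₁ e) → inj₂ (inj₁ e) ; (inj₂ (inj₁ e)) → inj₁ e ; (inj₂ (inj₂ e)) → inj₂ (inj₂ e) }

  Sat-⊇ : ∀ {t x y B B′} → (∀ {z} → z ∈ B → z ∈ B′) → Sat t x y B → Sat t x y B′
  Sat-⊇ sub sat size x∈ y∈ out = sat size x∈ y∈
    λ z∈ → case out z∈ of λ { (inj₁ e) → inj₁ e ; (inj₂ (inj₁ e)) → inj₂ (inj₁ e) ; (inj₂ (inj₂ z∉)) → inj₂ (inj₂ (z∉ ∘ sub)) }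

  Sat-mono : ∀ {s t x y B} → s ≤ t → Sat s x y B → Sat t x y B
  Sat-mono s≤t sat size x∈ y∈ out = mono-≤ s≤t (sat size x∈ y∈ out)

  2≤k : 2 ≤ k
  2≤k = ℕP.<⇒≤ 3≤k

  fillAvoiding : ∀ {l A B} → Unique l → length l ≤ 3 → length A ≤ robustness → length B ≤ exclusion →
    ∃ λ (f : Subset n) → ∣ f ∣ ≡ k × (∀ {z} → z ∈ l → z ∈ₛ f) × (∀ {z} → z ∈ₛ f → z ∈ l ⊎ (z ∉ A × z ∉ B))
  fillAvoiding {l} {A} {B} u l≤ A≤ B≤
    with fillSet k l (A ++ B) u (≤-trans l≤ 3≤k)
           (≤-trans (ℕP.+-monoʳ-≤ k (≤-trans (≤-reflexive (ListP.length-++ A)) (+-mono-≤ A≤ B≤))) (≤-trans minVertices≥ large))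
  ... | f , size , has , out = f , size , has ,
    λ z∈ → case out z∈ of λ { (inj₁ z∈l) → inj₁ z∈l ; (inj₂ z∉) → inj₂ (z∉ ∘ MemP.∈-++⁺ˡ , z∉ ∘ MemP.∈-++⁺ʳ A) }

  unique₂ : {x y : Fin n} → x ≢ y → Unique (x ∷ y ∷ [])
  unique₂ x≢y = (x≢y ∷ []) ∷ [] ∷ []

  unique₃ : {x y z : Fin n} → x ≢ y → x ≢ z → y ≢ z → Unique (x ∷ y ∷ z ∷ [])
  unique₃ x≢y x≢z y≢z = (x≢y ∷ x≢z ∷ []) ∷ unique₂ y≢z

  Sat⇒Rob : ∀ {t x y B} → Sat t x y B → length B ≤ exclusion → x ≢ y → Rob t x y
  Sat⇒Rob sat B≤ x≢y A A≤ _ with fillAvoiding (unique₂ x≢y) (s≤s (s≤s z≤n)) A≤ B≤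
  ... | f , size , has , out = f , sat size (has (here refl)) (has (there (here refl))) (λ z∈ → cases (proj₂) (out z∈)) ,
        size , has (here refl) , has (there (here refl)) , λ z∈ → cases proj₁ (out z∈)
    where
    cases : ∀ {P Q : Set} {z x y : Fin n} → (P → Q) → z ∈ x ∷ y ∷ [] ⊎ P → z ≡ x ⊎ z ≡ y ⊎ Q
    cases g (inj₁ (here e)) = inj₁ e
    cases g (inj₁ (there (here e))) = inj₂ (inj₁ e)
    cases g (inj₂ p) = inj₂ (inj₂ (g p))

  -- A place where `k ≥ 3` is essential: an edge through the saturated pair `x`, `w` can also
  -- contain `y`, and then serves the pair `x`, `y` with `w` as a private vertex. The price is that
  -- `w` has to be reserved.
  Sat⇒Avail : ∀ {t x w y B} → Sat t x w B → length B ≤ exclusion → x ≢ w → x ≢ y → w ≢ y → y ∉ B → Avail t x y (w ∷ [])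
  Sat⇒Avail {t} {x} {w} {y} {B} sat B≤ x≢w x≢y w≢y y∉B A A≤ dis with fillAvoiding (unique₃ x≢w x≢y w≢y) ≤-refl A≤ B≤
  ... | f , size , has , out = f , sat size (has (here refl)) (has (there (here refl))) (λ z∈ → inB (out z∈)) ,
        size , has (here refl) , has (there (there (here refl))) , λ z∈ → inA (out z∈)
    where
    inB : ∀ {z} → z ∈ x ∷ w ∷ y ∷ [] ⊎ (z ∉ A × z ∉ B) → z ≡ x ⊎ z ≡ w ⊎ z ∉ B
    inB (inj₁ (here e)) = inj₁ e
    inB (inj₁ (there (here e))) = inj₂ (inj₁ e)
    inB (inj₁ (there (there (here refl)))) = inj₂ (inj₂ y∉B)
    inB (inj₂ (_ , z∉B)) = inj₂ (inj₂ z∉B)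
    inA : ∀ {z} → z ∈ x ∷ w ∷ y ∷ [] ⊎ (z ∉ A × z ∉ B) → z ≡ x ⊎ z ≡ y ⊎ z ∉ A
    inA (inj₁ (here e)) = inj₁ e
    inA (inj₁ (there (here refl))) = inj₂ (inj₂ (dis (here refl)))
    inA (inj₁ (there (there (here e)))) = inj₂ (inj₁ e)
    inA (inj₂ (z∉A , _)) = inj₂ (inj₂ z∉A)

  -- Edges are chosen one at a time. `A₀` absorbs those already chosen, and each choice also avoids
  -- the reserves of the edges still to come. An edge thus costs at most `k` vertices, as a reserve
  -- before its choice and as a set after it, which keeps `K₀ + m′ * k` within `robustness`.
  greedy : ∀ {t} m′ (x y : Fin m′ → Fin n) (r : Fin m′ → List (Fin n)) A₀ {K₀} → length A₀ ≤ K₀ → K₀ + m′ * k ≤ robustness →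
    (∀ j → Avail t (x j) (y j) (r j)) → (∀ j → length (r j) ≤ k) →
    (∀ {i j z} → i ≢ j → z ∈ r i → z ∉ r j) → (∀ i j {z} → z ∈ r i → z ≢ x j × z ≢ y j) → (∀ i {z} → z ∈ r i → z ∉ A₀) →
    ∃ λ (h : Fin m′ → Subset n) → (∀ j → H t (h j) × Avoiding (x j) (y j) A₀ (h j)) ×
      (∀ {i j z} → i ≢ j → z ∈ₛ h i → z ∈ₛ h j → ∃ λ l → z ≡ x l ⊎ z ≡ y l)
  greedy zero x y r A₀ _ _ _ _ _ _ _ = (λ ()) , (λ ()) , λ { {()} }
  greedy {t} (suc m′) x y r A₀ {K₀} A₀≤ bound av r≤ r-disj r-core r-A₀
    with av zero (A₀ ++ concat (tabulate (r ∘ suc)))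
           (≤-trans (≤-reflexive (ListP.length-++ A₀))
             (≤-trans (+-mono-≤ A₀≤ (≤-trans (length-concat-tabulate m′ (r ∘ suc) (r≤ ∘ suc)) (ℕP.m≤n+m _ k))) bound))
           (λ z∈r z∈ → case MemP.∈-++⁻ A₀ z∈ of λ
             { (inj₁ z∈A₀) → r-A₀ zero z∈r z∈A₀
             ; (inj₂ z∈rs) → let i , z∈ri = ∈-concat-tabulate⁻ (r ∘ suc) z∈rs in r-disj (λ ()) z∈r z∈ri })
  ... | h₀ , Hh₀ , size₀ , x∈₀ , y∈₀ , out₀
    with greedy m′ (x ∘ suc) (y ∘ suc) (r ∘ suc) (A₀ ++ elems h₀)
           (≤-trans (≤-reflexive (trans (ListP.length-++ A₀) (cong (length A₀ +_) (trans (length-elems h₀) size₀)))) (ℕP.+-monoˡ-≤ k A₀≤))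
           (≤-trans (≤-reflexive (+-assoc K₀ k (m′ * k))) bound)
           (av ∘ suc) (r≤ ∘ suc) (λ i≢j → r-disj (i≢j ∘ FinP.suc-injective)) (λ i j → r-core (suc i) (suc j))
           (λ i z∈r z∈ → case MemP.∈-++⁻ A₀ z∈ of λ
             { (inj₁ z∈A₀) → r-A₀ (suc i) z∈r z∈A₀
             ; (inj₂ z∈h₀) → case out₀ (∈-elems⁻ z∈h₀) of λ
               { (inj₁ e) → proj₁ (r-core (suc i) zero z∈r) e
               ; (inj₂ (inj₁ e)) → proj₂ (r-core (suc i) zero z∈r) e
               ; (inj₂ (inj₂ z∉)) → z∉ (MemP.∈-++⁺ʳ A₀ (∈-concat-tabulate (r ∘ suc) i z∈r)) } })
  ... | h , chosen , meets = h′ , chosen′ , meets′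
    where
    h′ : Fin (suc m′) → Subset n
    h′ zero = h₀
    h′ (suc j) = h j
    chosen′ : ∀ j → H t (h′ j) × Avoiding (x j) (y j) A₀ (h′ j)
    chosen′ zero = Hh₀ , size₀ , x∈₀ , y∈₀ , λ z∈ → case out₀ z∈ of λ
      { (inj₁ e) → inj₁ e ; (inj₂ (inj₁ e)) → inj₂ (inj₁ e) ; (inj₂ (inj₂ z∉)) → inj₂ (inj₂ (z∉ ∘ MemP.∈-++⁺ˡ)) }
    chosen′ (suc j) with chosen j
    ... | Hh , size , x∈ , y∈ , out = Hh , size , x∈ , y∈ , λ z∈ → case out z∈ of λ
      { (inj₁ e) → inj₁ e ; (inj₂ (inj₁ e)) → inj₂ (inj₁ e) ; (inj₂ (inj₂ z∉)) → inj₂ (inj₂ (z∉ ∘ MemP.∈-++⁺ˡ)) }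
    meetZero : ∀ {j z} → z ∈ₛ h₀ → z ∈ₛ h j → ∃ λ l → z ≡ x l ⊎ z ≡ y l
    meetZero {j} z∈₀ z∈ with proj₂ (proj₂ (proj₂ (proj₂ (chosen j)))) z∈
    ... | inj₁ e = suc j , inj₁ e
    ... | inj₂ (inj₁ e) = suc j , inj₂ e
    ... | inj₂ (inj₂ z∉) = contradiction (MemP.∈-++⁺ʳ A₀ (∈-elems⁺ z∈₀)) z∉
    meets′ : ∀ {i j z} → i ≢ j → z ∈ₛ h′ i → z ∈ₛ h′ j → ∃ λ l → z ≡ x l ⊎ z ≡ y l
    meets′ {zero} {zero} i≢j _ _ = contradiction refl i≢j
    meets′ {zero} {suc j} _ z∈i z∈j = meetZero z∈i z∈j
    meets′ {suc i} {zero} _ z∈i z∈j = meetZero z∈j z∈i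
    meets′ {suc i} {suc j} i≢j z∈i z∈j with meets (i≢j ∘ cong suc) z∈i z∈j
    ... | l , e = suc l , e

  swapEdge : ∀ {t c h} → IsCopy k a b c h → ∀ j {f} → ∣ f ∣ ≡ k → c (a j) ∈ₛ f → c (b j) ∈ₛ f →
    (∀ v → c v ∈ₛ f → v ≡ a j ⊎ v ≡ b j) → (∀ i → i ≢ j → H t (h i)) →
    (∀ {i z} → i ≢ j → z ∈ₛ f → z ∈ₛ h i → ∃ λ v → z ≡ c v) → H (suc t) f
  swapEdge {t} {c} {h} copy j {f} size a∈ b∈ core Hh meet = subst (H (suc t)) (FunP.updateAt-updates j h)
    (complete j copy′ (λ i i≢j → subst (H t) (sym (FunP.updateAt-minimal i j h i≢j)) (Hh i i≢j)))
    where
    h′ : Fin m → Subset n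
    h′ = Fun.updateAt h j (λ _ → f)
    view : ∀ i → (i ≡ j × h′ i ≡ f) ⊎ (i ≢ j × h′ i ≡ h i)
    view i with i FinP.≟ j
    ... | yes refl = inj₁ (refl , FunP.updateAt-updates i h)
    ... | no i≢j = inj₂ (i≢j , FunP.updateAt-minimal i j h i≢j)
    copy′ : IsCopy k a b c h′
    copy′ .IsCopy.inj = IsCopy.inj copy
    copy′ .IsCopy.left i with view i
    ... | inj₁ (refl , e) = subst (_ ∈ₛ_) (sym e) a∈
    ... | inj₂ (_ , e) = subst (_ ∈ₛ_) (sym e) (IsCopy.left copy i)
    copy′ .IsCopy.right i with view i
    ... | inj₁ (refl , e) = subst (_ ∈ₛ_) (sym e) b∈
    ... | inj₂ (_ , e) = subst (_ ∈ₛ_) (sym e) (IsCopy.right copy i)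
    copy′ .IsCopy.core i v v∈ with view i
    ... | inj₁ (refl , e) = core v (subst (_ ∈ₛ_) e v∈)
    ... | inj₂ (_ , e) = IsCopy.core copy i v (subst (_ ∈ₛ_) e v∈)
    copy′ .IsCopy.meet {i} {i′} i≢i′ z∈ z∈′ with view i | view i′
    ... | inj₁ (refl , _) | inj₁ (refl , _) = contradiction refl i≢i′
    ... | inj₁ (refl , e) | inj₂ (i′≢j , e′) = meet i′≢j (subst (_ ∈ₛ_) e z∈) (subst (_ ∈ₛ_) e′ z∈′)
    ... | inj₂ (i≢j , e) | inj₁ (refl , e′) = meet i≢j (subst (_ ∈ₛ_) e′ z∈′) (subst (_ ∈ₛ_) e z∈)
    ... | inj₂ (_ , e) | inj₂ (_ , e′) = IsCopy.meet copy i≢i′ (subst (_ ∈ₛ_) e z∈) (subst (_ ∈ₛ_) e′ z∈′)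
    copy′ .IsCopy.size i with view i
    ... | inj₁ (_ , e) = trans (cong ∣_∣ e) size
    ... | inj₂ (_ , e) = trans (cong ∣_∣ e) (IsCopy.size copy i)

  -- `greedy` picks an edge at every pair, including the pair `j`, whose edge is then swapped for
  -- `f`. Since `f` belongs to the initial forbidden list, the other edges meet it only in the core.
  extendCore : ∀ {t c} → Injection c → ∀ j {f} → ∣ f ∣ ≡ k → c (a j) ∈ₛ f → c (b j) ∈ₛ f →
    (∀ v → c v ∈ₛ f → v ≡ a j ⊎ v ≡ b j) →
    (r : Fin m → List (Fin n)) → (∀ i → Avail t (c (a i)) (c (b i)) (r i)) → (∀ i → length (r i) ≤ k) →
    (∀ {i i′ z} → i ≢ i′ → z ∈ r i → z ∉ r i′) → (∀ i {z} v → z ∈ r i → z ≢ c v) → (∀ i {z} → z ∈ r i → z ∉ₛ f) →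
    H (suc t) f
  extendCore {t} {c} c-inj j {f} size a∈ b∈ core r av r≤ r-disj r-core r-f
    with greedy {t} m (c ∘ a) (c ∘ b) r (tabulate c ++ elems f)
           (≤-reflexive (trans (ListP.length-++ (tabulate c)) (cong₂ _+_ (ListP.length-tabulate c) (trans (length-elems f) size))))
           robustness≥ av r≤ r-disj (λ i l z∈ → r-core i (a l) z∈ , r-core i (b l) z∈)
           (λ i z∈r z∈ → case MemP.∈-++⁻ (tabulate c) z∈ of λ
             { (inj₁ z∈c) → let v , e = MemP.∈-tabulate⁻ z∈c in r-core i v z∈r e
             ; (inj₂ z∈f) → r-f i z∈r (∈-elems⁻ z∈f) })
  ... | h , chosen , meets = swapEdge copy j size a∈ b∈ core (λ i _ → proj₁ (chosen i)) meetF
    where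
    out : ∀ i {z} → z ∈ₛ h i → z ≡ c (a i) ⊎ z ≡ c (b i) ⊎ z ∉ (tabulate c ++ elems f)
    out i = proj₂ (proj₂ (proj₂ (proj₂ (chosen i))))
    meetF : ∀ {i z} → i ≢ j → z ∈ₛ f → z ∈ₛ h i → ∃ λ v → z ≡ c v
    meetF {i} _ z∈f z∈ with out i z∈
    ... | inj₁ e = a i , e
    ... | inj₂ (inj₁ e) = b i , e
    ... | inj₂ (inj₂ z∉) = contradiction (MemP.∈-++⁺ʳ (tabulate c) (∈-elems⁺ z∈f)) z∉
    copy : IsCopy k a b c h
    copy .IsCopy.inj = c-inj
    copy .IsCopy.left i = proj₁ (proj₂ (proj₂ (chosen i)))
    copy .IsCopy.right i = proj₁ (proj₂ (proj₂ (proj₂ (chosen i))))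
    copy .IsCopy.core i v v∈ with out i v∈
    ... | inj₁ e = inj₁ (c-inj e)
    ... | inj₂ (inj₁ e) = inj₂ (c-inj e)
    ... | inj₂ (inj₂ z∉) = contradiction (MemP.∈-++⁺ˡ (MemP.∈-tabulate⁺ v)) z∉
    copy .IsCopy.meet i≢i′ z∈ z∈′ with meets i≢i′ z∈ z∈′
    ... | l , inj₁ e = a l , e
    ... | l , inj₂ e = b l , e
    copy .IsCopy.size i = proj₁ (proj₂ (chosen i))

  CoreSat : ℕ → (Fin p → Fin n) → Set
  CoreSat t c = ∀ j → Sat t (c (a j)) (c (b j)) (tabulate c)

  core∩ : ∀ {c : Fin p → Fin n} {f : Subset n} {B : List (Fin n)} {u v} → Injection c → (∀ w → c w ∈ B) →
    (∀ {z} → z ∈ₛ f → z ≡ c u ⊎ z ≡ c v ⊎ z ∉ B) → ∀ w → c w ∈ₛ f → w ≡ u ⊎ w ≡ v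
  core∩ c-inj c∈B out w w∈ with out w∈
  ... | inj₁ e = inj₁ (c-inj e)
  ... | inj₂ (inj₁ e) = inj₂ (c-inj e)
  ... | inj₂ (inj₂ w∉) = contradiction (c∈B w) w∉

  Rob⇒CoreSat : ∀ {t c} → Injection c → (∀ j → Rob t (c (a j)) (c (b j))) → CoreSat (suc t) c
  Rob⇒CoreSat c-inj rob j size a∈ b∈ out =
    extendCore c-inj j size a∈ b∈ (core∩ c-inj MemP.∈-tabulate⁺ out) (λ _ → []) rob (λ _ → z≤n) (λ _ ()) (λ _ _ ()) (λ _ ())

  core≤exclusion : (c : Fin p → Fin n) → length (tabulate c) ≤ exclusion
  core≤exclusion c = ≤-trans (≤-reflexive (ListP.length-tabulate c)) (≤-trans (ℕP.m≤m+n p (m * k)) exclusion≥copy)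

  CoreSat⇒Rob : ∀ {t c} → Injection c → CoreSat t c → ∀ j → Rob t (c (a j)) (c (b j))
  CoreSat⇒Rob {c = c} c-inj sat j = Sat⇒Rob (sat j) (core≤exclusion c) (a≢b j ∘ c-inj)

  module _ {t : ℕ} (new : NewEdge k a b H t) where
    open NewEdge new
    open IsCopy isCopy

    -- Any edge of a completed copy can be exchanged for another k-set through the same core pair.
    newEdge⇒CoreSat : CoreSat (3 + t) vertex
    -- The exchange alone, done at time `2 + t`, requires sets that avoid the whole copy. Passing to
    -- robust pairs and building new copies on the same core shrinks the exclusion list to the core,
    -- at the cost of the third step.
    newEdge⇒CoreSat = Rob⇒CoreSat inj λ j → Sat⇒Rob (sat j) B≤ (a≢b j ∘ inj)
      where
      B : List (Fin n)
      B = tabulate vertex ++ concat (tabulate (elems ∘ edge))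
      B≤ : length B ≤ exclusion
      B≤ = ≤-trans (≤-reflexive (trans (ListP.length-++ (tabulate vertex)) (cong (_+ _) (ListP.length-tabulate vertex))))
        (≤-trans (ℕP.+-monoʳ-≤ p (length-concat-tabulate m (elems ∘ edge) (λ j → ≤-reflexive (trans (length-elems (edge j)) (size j)))))
          exclusion≥copy)
      sat : ∀ j → Sat (2 + t) (vertex (a j)) (vertex (b j)) B
      sat j sz a∈ b∈ out = swapEdge isCopy j sz a∈ b∈ (core∩ inj (MemP.∈-++⁺ˡ ∘ MemP.∈-tabulate⁺) out) (λ i _ → built i) meetF
        where
        meetF : ∀ {i z} → i ≢ j → z ∈ₛ _ → z ∈ₛ edge i → ∃ λ v → z ≡ vertex v
        meetF {i} _ z∈f z∈ with out z∈f
        ... | inj₁ e = a j , e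
        ... | inj₂ (inj₁ e) = b j , e
        ... | inj₂ (inj₂ z∉) = contradiction (MemP.∈-++⁺ʳ (tabulate vertex) (∈-concat-tabulate (elems ∘ edge) i (∈-elems⁺ z∈))) z∉

    -- The absent edge meets the core only in its two ends, so a saturated core would already have
    -- brought it in.
    newEdge-late : ∀ {s} → CoreSat s vertex → ¬ s ≤ t
    newEdge-late sat s≤t = absent (mono-≤ s≤t (sat label (size label) (left label) (right label) out))
      where
      out : ∀ {z} → z ∈ₛ edge label → z ≡ vertex (a label) ⊎ z ≡ vertex (b label) ⊎ z ∉ tabulate vertex
      out {z} z∈ with z ∈? tabulate vertex
      ... | no z∉ = inj₂ (inj₂ z∉)
      ... | yes z∈c with MemP.∈-tabulate⁻ z∈c
      ... | v , refl with core label v z∈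
      ... | inj₁ e = inj₁ (cong vertex e)
      ... | inj₂ e = inj₂ (inj₁ (cong vertex e))

  -- Hubs

  record Hub : Set where
    field
      centre    : Fin n
      leaf      : Fin hubDegree → Fin n
      leaf-inj  : Injection leaf
      excluded  : List (Fin n)
      excluded≤ : length excluded ≤ hubSize
  open Hub

  Live : ℕ → Hub → Set
  Live t h = ∀ i → Sat t (centre h) (leaf h i) (excluded h)

  Live-mono : ∀ {s t h} → s ≤ t → Live s h → Live t h
  Live-mono s≤t live i = Sat-mono s≤t (live i)

  -- A leaf serves as the private vertex of an edge through the centre and `z`. It is chosen after
  -- `A` is known, so nothing stays reserved.
  hub⇒Rob : ∀ {t z} (h : Hub) → Live t h → centre h ≢ z → z ∉ excluded h → Rob t (centre h) z
  hub⇒Rob {z = z} h live x≢z z∉ A A≤ _ with escape (leaf h) (leaf-inj h) (centre h ∷ z ∷ A) (≤-trans (s≤s (s≤s (s≤s A≤))) hubDegree≥)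
  ... | i , i∉ = Sat⇒Avail (live i) (≤-trans (excluded≤ h) exclusion≥hub) (λ e → i∉ (here (sym e))) x≢z
                   (λ e → i∉ (there (here e))) z∉ A A≤ (λ { (here refl) → i∉ ∘ there ∘ there })

  -- Every pair of vertices of the prospective core is robust, so `G` can be placed there in any way
  -- that puts edge `j` on `z`, `w`. At the ends of `j` the values of `g` are overwritten by `z` and
  -- `w`.
  poolStep : ∀ {t} j {z w f} → ∣ f ∣ ≡ k → z ∈ₛ f → w ∈ₛ f → z ≢ w →
    (g : Fin p → Fin n) → Injection g → (∀ v → g v ∉ₛ f) →
    Rob t z w → (∀ v → Rob t z (g v)) → (∀ v → Rob t w (g v)) → (∀ {u v} → u ≢ v → Rob t (g u) (g v)) → H (suc t) f
  poolStep {t} j {z} {w} {f} size z∈ w∈ z≢w g g-inj g∉ Rzw Rzg Rwg Rgg =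
    extendCore c-inj j size (subst (_∈ₛ f) (sym ca) z∈) (subst (_∈ₛ f) (sym cb) w∈) core
      (λ _ → []) (λ i → rob (a≢b i)) (λ _ → z≤n) (λ _ ()) (λ _ _ ()) (λ _ ())
    where
    c : Fin p → Fin n
    c v with v FinP.≟ a j | v FinP.≟ b j
    ... | yes _ | _ = z
    ... | no _ | yes _ = w
    ... | no _ | no _ = g v
    view : ∀ v → (v ≡ a j × c v ≡ z) ⊎ (v ≡ b j × c v ≡ w) ⊎ (c v ≡ g v)
    view v with v FinP.≟ a j | v FinP.≟ b j
    ... | yes e | _ = inj₁ (e , refl)
    ... | no _ | yes e = inj₂ (inj₁ (e , refl))
    ... | no _ | no _ = inj₂ (inj₂ refl)
    ca : c (a j) ≡ z
    ca with a j FinP.≟ a j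
    ... | yes _ = refl
    ... | no ne = contradiction refl ne
    cb : c (b j) ≡ w
    cb with b j FinP.≟ a j | b j FinP.≟ b j
    ... | yes e | _ = contradiction (sym e) (a≢b j)
    ... | no _ | yes _ = refl
    ... | no _ | no ne = contradiction refl ne
    core : ∀ v → c v ∈ₛ f → v ≡ a j ⊎ v ≡ b j
    core v v∈ with view v
    ... | inj₁ (e , _) = inj₁ e
    ... | inj₂ (inj₁ (e , _)) = inj₂ e
    ... | inj₂ (inj₂ e) = contradiction (subst (_∈ₛ f) e v∈) (g∉ v)
    c-inj : Injection c
    c-inj {u} {v} eq with view u | view v
    ... | inj₁ (eu , _) | inj₁ (ev , _) = trans eu (sym ev)
    ... | inj₁ (_ , cu) | inj₂ (inj₁ (_ , cv)) = contradiction (trans (sym cu) (trans eq cv)) z≢w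
    ... | inj₁ (_ , cu) | inj₂ (inj₂ cv) = contradiction (subst (_∈ₛ f) (trans (sym cu) (trans eq cv)) z∈) (g∉ v)
    ... | inj₂ (inj₁ (_ , cu)) | inj₁ (_ , cv) = contradiction (trans (sym cv) (trans (sym eq) cu)) z≢w
    ... | inj₂ (inj₁ (eu , _)) | inj₂ (inj₁ (ev , _)) = trans eu (sym ev)
    ... | inj₂ (inj₁ (_ , cu)) | inj₂ (inj₂ cv) = contradiction (subst (_∈ₛ f) (trans (sym cu) (trans eq cv)) w∈) (g∉ v)
    ... | inj₂ (inj₂ cu) | inj₁ (_ , cv) = contradiction (subst (_∈ₛ f) (trans (sym cv) (trans (sym eq) cu)) z∈) (g∉ u)
    ... | inj₂ (inj₂ cu) | inj₂ (inj₁ (_ , cv)) = contradiction (subst (_∈ₛ f) (trans (sym cv) (trans (sym eq) cu)) w∈) (g∉ u)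
    ... | inj₂ (inj₂ cu) | inj₂ (inj₂ cv) = g-inj (trans (sym cu) (trans eq cv))
    rob : ∀ {u v} → u ≢ v → Rob t (c u) (c v)
    rob {u} {v} u≢v with view u | view v
    ... | inj₁ (eu , _) | inj₁ (ev , _) = contradiction (trans eu (sym ev)) u≢v
    ... | inj₁ (_ , cu) | inj₂ (inj₁ (_ , cv)) = subst₂ (Rob t) (sym cu) (sym cv) Rzw
    ... | inj₁ (_ , cu) | inj₂ (inj₂ cv) = subst₂ (Rob t) (sym cu) (sym cv) (Rzg v)
    ... | inj₂ (inj₁ (_ , cu)) | inj₁ (_ , cv) = subst₂ (Rob t) (sym cu) (sym cv) (Avail-sym Rzw)
    ... | inj₂ (inj₁ (eu , _)) | inj₂ (inj₁ (ev , _)) = contradiction (trans eu (sym ev)) u≢v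
    ... | inj₂ (inj₁ (_ , cu)) | inj₂ (inj₂ cv) = subst₂ (Rob t) (sym cu) (sym cv) (Rwg v)
    ... | inj₂ (inj₂ cu) | inj₁ (_ , cv) = subst₂ (Rob t) (sym cu) (sym cv) (Avail-sym (Rzg u))
    ... | inj₂ (inj₂ cu) | inj₂ (inj₁ (_ , cv)) = subst₂ (Rob t) (sym cu) (sym cv) (Avail-sym (Rwg u))
    ... | inj₂ (inj₂ cu) | inj₂ (inj₂ cv) = subst₂ (Rob t) (sym cu) (sym cv) (Rgg u≢v)

  -- A pool of separate hubs adds every `k`-set

  module _ {t : ℕ} (j : Fin m) (X : Fin poolSize → Hub) (live : ∀ i → Live t (X i))
    (centre-inj : Injection (centre ∘ X))
    (apart : ∀ {i i′} → i ≢ i′ → centre (X i) ∉ excluded (X i′)) where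

    private
      x : Fin poolSize → Fin n
      x = centre ∘ X

    opaque
      outer : List (Fin n)
      outer = concat (tabulate λ i → x i ∷ excluded (X i))

      outer≤ : length outer ≤ exclusion
      outer≤ = ≤-trans (length-concat-tabulate poolSize (λ i → x i ∷ excluded (X i)) (λ i → s≤s (excluded≤ (X i))))
        exclusion≥pool

      x∈outer : ∀ i → x i ∈ outer
      x∈outer i = ∈-concat-tabulate (λ i → x i ∷ excluded (X i)) i (here refl)

      ∉excluded : ∀ {z} i → z ∉ outer → z ∉ excluded (X i)
      ∉excluded i z∉ z∈ = z∉ (∈-concat-tabulate (λ i → x i ∷ excluded (X i)) i (there z∈))

    -- The core consists of the hub `x i`, one more vertex `z` of `f`, and further hubs. Each pair
    -- in it contains a centre whose exclusion list misses the other vertex: by `apart` for two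
    -- centres, and because `z` is not in `outer` otherwise.
    strongHub : ∀ i {f} → ∣ f ∣ ≡ k → x i ∈ₛ f → (∀ {z} → z ∈ₛ f → z ≡ x i ⊎ z ∉ outer) → H (suc t) f
    strongHub i {f} size x∈ out with pick f (x i ∷ []) (≤-trans 2≤k (≤-reflexive (sym size)))
    ... | z , z∈ , z∉x = poolStep j size x∈ z∈ (λ e → z∉x (here (sym e))) g g-inj g∉
            (hub⇒Rob (X i) (live i) (λ e → z∉x (here (sym e))) (∉excluded i z∉outer))
            (λ v → hubs (FinP.punchInᵢ≢i i _ ∘ sym))
            (λ v → Avail-sym (hub⇒Rob (X _) (live _) (λ e → z∉outer (subst (_∈ outer) e (x∈outer _))) (∉excluded _ z∉outer)))
            (λ u≢v → hubs (u≢v ∘ choose-inj))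
      where
      z∉outer : z ∉ outer
      z∉outer with out z∈
      ... | inj₁ e = contradiction (here e) z∉x
      ... | inj₂ z∉ = z∉
      choose : Fin p → Fin poolSize
      choose v = Fin.punchIn i (Fin.inject≤ v spareHubs≥p)
      choose-inj : Injection choose
      choose-inj eq = FinP.inject≤-injective spareHubs≥p spareHubs≥p _ _ (FinP.punchIn-injective i _ _ eq)
      g : Fin p → Fin n
      g = x ∘ choose
      g-inj : Injection g
      g-inj = choose-inj ∘ centre-inj
      g∉ : ∀ v → g v ∉ₛ f
      g∉ v v∈ with out v∈
      ... | inj₁ e = FinP.punchInᵢ≢i i _ (centre-inj e)
      ... | inj₂ v∉ = v∉ (x∈outer _)
      hubs : ∀ {i i′} → i ≢ i′ → Rob t (x i) (x i′)
      hubs i≢i′ = hub⇒Rob (X _) (live _) (i≢i′ ∘ centre-inj) (apart (i≢i′ ∘ sym))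

    freshPool : ∀ {f : Subset n} → ∣ f ∣ ≡ k → ∃ λ (g : Fin p → Fin n) → Injection g × (∀ v → g v ∉ outer) × (∀ v → g v ∉ₛ f)
    freshPool {f} size with freshFamily p (outer ++ elems f) bound
      where
      bound : p + length (outer ++ elems f) ≤ n
      bound = begin
        p + length (outer ++ elems f) ≡⟨ cong (p +_) (ListP.length-++ outer) ⟩
        p + (length outer + length (elems f)) ≡⟨ cong (λ l → p + (length outer + l)) (trans (length-elems f) size) ⟩
        p + (length outer + k) ≡⟨ cong (p +_) (+-comm (length outer) k) ⟩
        p + (k + length outer) ≡⟨ sym (+-assoc p k _) ⟩
        p + k + length outer ≤⟨ +-mono-≤ (≤-trans (ℕP.m≤m+n (p + k) (m * k)) robustness≥) outer≤ ⟩
        robustness + exclusion ≤⟨ ℕP.m≤n+m _ k ⟩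
        k + (robustness + exclusion) ≤⟨ minVertices≥ ⟩
        minVertices ≤⟨ large ⟩
        n ∎
        where open ℕP.≤-Reasoning
    ... | g , g-inj , g∉ = g , g-inj , (λ v → g∉ v ∘ MemP.∈-++⁺ˡ) , λ v → g∉ v ∘ MemP.∈-++⁺ʳ outer ∘ ∈-elems⁺

    -- Some hub lies outside `A`, and its centre is used as a private vertex of the edge through `s`
    -- and `s′`; `strongHub` has already added that edge.
    robOutside : ∀ {s s′} → s ≢ s′ → s ∉ outer → s′ ∉ outer → Rob (suc t) s s′
    robOutside {s} {s′} s≢s′ s∉ s′∉ A A≤ _
      with escape x centre-inj (s ∷ s′ ∷ A) (s≤s (≤-trans (s≤s (s≤s A≤)) spareHubs≥robustness))
    ... | i , i∉ with fillAvoiding (unique₃ (i∉ ∘ here) (i∉ ∘ there ∘ here) s≢s′) ≤-refl A≤ outer≤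
    ... | f , size , has , out = f , strongHub i size (has (here refl)) (λ z∈ → inOuter (out z∈)) ,
          size , has (there (here refl)) , has (there (there (here refl))) , λ z∈ → inA (out z∈)
      where
      inOuter : ∀ {z} → z ∈ x i ∷ s ∷ s′ ∷ [] ⊎ (z ∉ A × z ∉ outer) → z ≡ x i ⊎ z ∉ outer
      inOuter (inj₁ (here e)) = inj₁ e
      inOuter (inj₁ (there (here refl))) = inj₂ s∉
      inOuter (inj₁ (there (there (here refl)))) = inj₂ s′∉
      inOuter (inj₂ (_ , z∉)) = inj₂ z∉
      inA : ∀ {z} → z ∈ x i ∷ s ∷ s′ ∷ [] ⊎ (z ∉ A × z ∉ outer) → z ≡ s ⊎ z ≡ s′ ⊎ z ∉ A
      inA (inj₁ (here refl)) = inj₂ (inj₂ (i∉ ∘ there ∘ there))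
      inA (inj₁ (there (here e))) = inj₁ e
      inA (inj₁ (there (there (here e)))) = inj₂ (inj₁ e)
      inA (inj₂ (z∉ , _)) = inj₂ (inj₂ z∉)

    fillThird : ∀ {s s′} → s ≢ s′ → ∀ A → length A ≤ robustness →
      ∃₂ λ f u → Avoiding s s′ A f × u ∈ₛ f × u ∉ outer × u ≢ s × u ≢ s′
    fillThird {s} {s′} s≢s′ A A≤ with fillAvoiding (unique₂ s≢s′) (s≤s (s≤s z≤n)) A≤ outer≤
    ... | f , size , has , out with pick f (s ∷ s′ ∷ []) (≤-trans 3≤k (≤-reflexive (sym size)))
    ... | u , u∈ , u∉ = f , u , (size , has (here refl) , has (there (here refl)) , λ z∈ → inA (out z∈)) , u∈ , u∉outer ,
          u∉ ∘ here , u∉ ∘ there ∘ here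
      where
      inA : ∀ {z} → z ∈ s ∷ s′ ∷ [] ⊎ (z ∉ A × z ∉ outer) → z ≡ s ⊎ z ≡ s′ ⊎ z ∉ A
      inA (inj₁ (here e)) = inj₁ e
      inA (inj₁ (there (here e))) = inj₂ (inj₁ e)
      inA (inj₂ (z∉ , _)) = inj₂ (inj₂ z∉)
      u∉outer : u ∉ outer
      u∉outer with out u∈
      ... | inj₁ u∈l = contradiction u∈l u∉
      ... | inj₂ (_ , u∉o) = u∉o

    -- From here on the requirement on a `k`-set relaxes with each step: two vertices outside
    -- `outer`, then one, then none. In between, `fillThird` plants an outside vertex in an edge
    -- through a given pair, so the pair itself needs one outside vertex fewer than the edge.
    twoOutside : ∀ {f z w} → ∣ f ∣ ≡ k → z ∈ₛ f → w ∈ₛ f → z ≢ w → z ∉ outer → w ∉ outer → H (2 + t) f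
    twoOutside size z∈ w∈ z≢w z∉ w∉ with freshPool size
    ... | g , g-inj , g∉ , g∉f = poolStep j size z∈ w∈ z≢w g g-inj g∉f (robOutside z≢w z∉ w∉)
          (λ v → robOutside (λ { refl → g∉f v z∈ }) z∉ (g∉ v)) (λ v → robOutside (λ { refl → g∉f v w∈ }) w∉ (g∉ v))
          (λ u≢v → robOutside (u≢v ∘ g-inj) (g∉ _) (g∉ _))

    robHalf : ∀ {s s′} → s ≢ s′ → s ∉ outer → Rob (2 + t) s s′
    robHalf s≢s′ s∉ A A≤ _ =
      let f , u , av , u∈ , u∉ , u≢s , _ = fillThird s≢s′ A A≤
      in f , twoOutside (proj₁ av) (proj₁ (proj₂ av)) u∈ (u≢s ∘ sym) s∉ u∉ , av

    oneOutside : ∀ {f z} → ∣ f ∣ ≡ k → z ∈ₛ f → z ∉ outer → H (3 + t) f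
    oneOutside {f} {z} size z∈ z∉ with freshPool size | pick f (z ∷ []) (≤-trans 2≤k (≤-reflexive (sym size)))
    ... | g , g-inj , g∉ , g∉f | w , w∈ , w∉z = poolStep j size z∈ w∈ (λ e → w∉z (here (sym e))) g g-inj g∉f
          (robHalf (λ e → w∉z (here (sym e))) z∉)
          (λ v → robHalf (λ { refl → g∉f v z∈ }) z∉) (λ v → Avail-sym (robHalf (λ { refl → g∉f v w∈ }) (g∉ v)))
          (λ u≢v → robHalf (u≢v ∘ g-inj) (g∉ _))

    robAll : ∀ {s s′} → s ≢ s′ → Rob (3 + t) s s′
    robAll s≢s′ A A≤ _ =
      let f , u , av , u∈ , u∉ , _ = fillThird s≢s′ A A≤
      in f , oneOutside (proj₁ av) u∈ u∉ , av

    everything : ∀ {f} → ∣ f ∣ ≡ k → H (4 + t) f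
    everything {f} size with freshPool size | pick f [] (≤-trans (ℕP.<⇒≤ 2≤k) (≤-reflexive (sym size)))
    ... | g , g-inj , g∉ , g∉f | z , z∈ , _ with pick f (z ∷ []) (≤-trans 2≤k (≤-reflexive (sym size)))
    ... | w , w∈ , w∉z = poolStep j size z∈ w∈ (λ e → w∉z (here (sym e))) g g-inj g∉f (robAll (λ e → w∉z (here (sym e))))
          (λ v → robAll (λ { refl → g∉f v z∈ })) (λ v → robAll (λ { refl → g∉f v w∈ })) (λ u≢v → robAll (u≢v ∘ g-inj))

  -- Selecting separate hubs

  Distinct Excludes Separate : Hub → Hub → Set
  Distinct h h′ = centre h ≢ centre h′
  Excludes h h′ = centre h′ ∈ excluded h
  Separate h h′ = Distinct h h′ × ¬ Excludes h h′ × ¬ Excludes h′ h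

  -- The dense outcome of the dichotomy is impossible: it would put `suc hubSize` distinct centres
  -- into the exclusion list of a single hub.
  fewExcluded : ∀ r (hs : List Hub) → AllPairs Distinct hs → dichotomyLength r (suc hubSize) ≤ length hs →
    ∃ λ hs′ → hs′ ⊆ hs × length hs′ ≡ r × AllPairs (λ h h′ → ¬ Excludes h h′) hs′
  fewExcluded r hs distinct le with dichotomy (λ h h′ → centre h′ ∈? excluded h) r (suc hubSize) hs le
  ... | inj₁ sparse = sparse
  ... | inj₂ (h , hs′ , h∈ , sub , len , all) =
    let i , i∉ = escape (centre ∘ lookup hs′) inj (excluded h) (≤-trans (s≤s (excluded≤ h)) (≤-reflexive (sym len)))
    in contradiction (All.lookup all (MemP.∈-lookup i)) i∉
    where
    inj : Injection (centre ∘ lookup hs′)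
    inj {i} {j} eq with i FinP.≟ j
    ... | yes i≡j = i≡j
    ... | no i≢j = contradiction eq (AllPairs-lookup (λ ne → ne ∘ sym) (AllPairs-resp-⊆ sub distinct) i≢j)

  -- One pass only prevents earlier hubs from excluding later centres. A second pass over the
  -- reversed list prevents the other direction.
  separateHubs : ∀ hs → AllPairs Distinct hs → hubCount ≤ length hs →
    ∃ λ (X : Fin poolSize → Hub) → (∀ i → X i ∈ hs) × (∀ {i i′} → i ≢ i′ → Separate (X i) (X i′))
  separateHubs hs distinct le with fewExcluded (dichotomyLength poolSize (suc hubSize)) hs distinct (≤-trans hubCount≥ le)
  ... | hs₁ , sub₁ , len₁ , ap₁
    with fewExcluded poolSize (reverse hs₁)
           (AllPairs.map (λ ne → ne ∘ sym) (AllPairs-reverse (AllPairs-resp-⊆ sub₁ distinct)))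
           (≤-reflexive (sym (trans (ListP.length-reverse hs₁) len₁)))
  ... | hs₂ , sub₂ , len₂ , ap₂ = X , (λ i → SublistP.Any-resp-⊆ sub₁ (AnyP.reverse⁻ (SublistP.Any-resp-⊆ sub₂ (MemP.∈-lookup _)))) ,
        λ i≢i′ → AllPairs-lookup (λ (ne , ex , ex′) → ne ∘ sym , ex′ , ex)
          (AllPairs-× (AllPairs.map (λ ne → ne ∘ sym) (AllPairs-resp-⊆ sub₂ (AllPairs-reverse (AllPairs-resp-⊆ sub₁ distinct))))
            (AllPairs-× ap₂ (AllPairs-resp-⊆ sub₂ (AllPairs-reverse ap₁))))
          (i≢i′ ∘ cast-inj)
    where
    X : Fin poolSize → Hub
    X i = lookup hs₂ (Fin.cast (sym len₂) i)
    cast-inj : Injection (Fin.cast (sym len₂))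
    cast-inj {i} {j} eq = FinP.toℕ-injective (trans (sym (FinP.toℕ-cast (sym len₂) i)) (trans (cong toℕ eq) (FinP.toℕ-cast (sym len₂) j)))

  -- A new hub from a sunflower of cores

  satJoin : ∀ {t c j u v} → CoreSat t c → Joins a b j u v → Sat t (c u) (c v) (tabulate c)
  satJoin sat (inj₁ (refl , refl)) = sat _
  satJoin sat (inj₂ (refl , refl)) = Sat-sym (sat _)

  -- All cores are saturated at time `t`, and `ψ zero` already at the earlier time `s`. The core
  -- `ψ o` still has a pair that is not robust at time `s`; this rules out the one case in which the
  -- sunflower yields no hub.
  module _ {s t : ℕ} (s≤t : s ≤ t) (hs : List Hub) (live : All (Live s) hs)
    (ψ : Fin (suc hubDegree) → Fin p → Fin n) (ψ-inj : ∀ i → Injection (ψ i))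
    (free : List (Fin p))
    (kernel : ∀ {v} → v ∉ free → ∀ i i′ → ψ i v ≡ ψ i′ v)
    (petal : ∀ {i i′ v w} → i ≢ i′ → v ∈ free → w ∈ free → ψ i v ≢ ψ i′ w)
    (off : ∀ i {v h} → v ∈ free → h ∈ hs → ψ i v ≢ centre h × ψ i v ∉ excluded h)
    (sat : ∀ i → CoreSat t (ψ i)) (sat₀ : CoreSat s (ψ zero))
    (o : Fin (suc hubDegree)) (stuck : ¬ (∀ j → Rob s (ψ o (a j)) (ψ o (b j))))
    where

    private
      σ : Fin p → Fin n
      σ = ψ zero

      centres : List (Fin n)
      centres = map centre hs

      NewHub : Set
      NewHub = ∃ λ h → Live (suc t) h × All (Distinct h) hs

      distinctHub : ∀ {h} → centre h ∉ centres → All (Distinct h) hs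
      distinctHub ∉centres = All.tabulate λ h∈ e → ∉centres (subst (_∈ centres) (sym e) (MemP.∈-map⁺ centre h∈))

    opaque
      union : List (Fin n)
      union = concat (tabulate λ i → tabulate (ψ i))

      union≤ : length union ≤ hubSize
      union≤ = ≤-trans (length-concat-tabulate (suc hubDegree) (λ i → tabulate (ψ i)) (λ i → ≤-reflexive (ListP.length-tabulate (ψ i)))) hubSize≥

      ∈union : ∀ i v → ψ i v ∈ union
      ∈union i v = ∈-concat-tabulate (λ i → tabulate (ψ i)) i (MemP.∈-tabulate⁺ v)

    core⊆union : ∀ i {z} → z ∈ tabulate (ψ i) → z ∈ union
    core⊆union i z∈ with MemP.∈-tabulate⁻ z∈
    ... | v , refl = ∈union i v

    leaves-inj : ∀ {v} → v ∈ free → Injection (λ i → ψ (suc i) v)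
    leaves-inj v∈ {i} {i′} eq with i FinP.≟ i′
    ... | yes i≡i′ = i≡i′
    ... | no i≢i′ = contradiction eq (petal (i≢i′ ∘ FinP.suc-injective) v∈ v∈)

    -- For free `v` the petals are disjoint. For `v` in the kernel, `σ v` is also the vertex at
    -- position `v` of core `i`, and injectivity of that core separates it from position `u`.
    petal-core : ∀ {i u v} → u ∈ free → i ≢ zero → ψ i u ≢ σ v
    petal-core {i} {u} {v} u∈ i≢0 e with v ∈? free
    ... | yes v∈ = petal i≢0 u∈ v∈ e
    ... | no v∉ = v∉ (subst (_∈ free) (ψ-inj i (trans e (kernel v∉ zero i))) u∈)

    core-petal : ∀ {i u v} → u ∈ free → i ≢ zero → σ u ≢ ψ i v
    core-petal {i} {u} {v} u∈ i≢0 e with v ∈? free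
    ... | yes v∈ = petal (i≢0 ∘ sym) u∈ v∈ e
    ... | no v∉ = v∉ (subst (_∈ free) (ψ-inj zero (trans e (kernel v∉ i zero))) u∈)

    kernelHub : ∀ {j u v} → Joins a b j u v → u ∉ free → v ∈ free → σ u ∉ centres → NewHub
    kernelHub {j} {u} {v} joins u∉ v∈ ∉centres = hub , live′ , distinctHub {hub} ∉centres
      where
      hub : Hub
      hub = record { centre = σ u ; leaf = λ i → ψ (suc i) v ; leaf-inj = leaves-inj v∈ ; excluded = union ; excluded≤ = union≤ }
      live′ : Live (suc t) hub
      live′ i = Sat-mono (ℕP.n≤1+n t)
        (subst (λ x → Sat t x (ψ (suc i) v) union) (kernel u∉ (suc i) zero)
          (Sat-⊇ (core⊆union (suc i)) (satJoin (sat (suc i)) joins)))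

    -- By `off`, free vertices of all petals miss the exclusion lists of the old hubs, so an old
    -- centre in the kernel reaches each of them.
    robCentre : ∀ {r u v} → All (Live r) hs → u ∉ free → v ∈ free → σ u ∈ centres → ∀ i i′ → Rob r (ψ i u) (ψ i′ v)
    robCentre {r} {u} {v} live′ u∉ v∈ ∈centres i i′ with MemP.∈-map⁻ centre ∈centres
    ... | h , h∈ , e = subst (λ x → Rob r x (ψ i′ v)) (trans (sym e) (kernel u∉ zero i))
          (hub⇒Rob h (All.lookup live′ h∈) (λ e′ → proj₁ (off i′ v∈ h∈) (sym e′)) (proj₂ (off i′ v∈ h∈)))

    private
      Boundary : Set
      Boundary = ∀ {j u v} → Joins a b j u v → u ∉ free → v ∈ free → σ u ∈ centres

    -- Moving the end a e of a free edge from the other petals to petal 0: the moved vertex is joined to the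
    -- free neighbours u through the private vertices σ u.
    module _ (boundary : Boundary) (e : Fin m) (a∈ : a e ∈ free) (b∈ : b e ∈ free) where

      private
        w : Fin p
        w = a e

      cross : Fin hubDegree → Fin p → Fin n
      cross i v with v FinP.≟ w
      ... | yes _ = σ w
      ... | no _ = ψ (suc i) v

      cross-view : ∀ i v → (v ≡ w × cross i v ≡ σ w) ⊎ (v ≢ w × cross i v ≡ ψ (suc i) v)
      cross-view i v with v FinP.≟ w
      ... | yes eq = inj₁ (eq , refl)
      ... | no ne = inj₂ (ne , refl)

      cross-here : ∀ i {v} → v ≡ w → cross i v ≡ σ w
      cross-here i {v} v≡w with cross-view i v
      ... | inj₁ (_ , eq) = eq
      ... | inj₂ (v≢w , _) = contradiction v≡w v≢w

      cross-else : ∀ i {v} → v ≢ w → cross i v ≡ ψ (suc i) v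
      cross-else i {v} v≢w with cross-view i v
      ... | inj₁ (v≡w , _) = contradiction v≡w v≢w
      ... | inj₂ (_ , eq) = eq

      cross-inj : ∀ i → Injection (cross i)
      cross-inj i {u} {v} eq with cross-view i u | cross-view i v
      ... | inj₁ (eu , _) | inj₁ (ev , _) = trans eu (sym ev)
      ... | inj₁ (_ , cu) | inj₂ (_ , cv) = contradiction (trans (sym cu) (trans eq cv)) (core-petal a∈ (λ ()))
      ... | inj₂ (_ , cu) | inj₁ (_ , cv) = contradiction (trans (sym cv) (trans (sym eq) cu)) (core-petal a∈ (λ ()))
      ... | inj₂ (_ , cu) | inj₂ (_ , cv) = ψ-inj (suc i) (trans (sym cu) (trans eq cv))

      cross∈union : ∀ i v → cross i v ∈ union
      cross∈union i v with cross-view i v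
      ... | inj₁ (_ , eq) = subst (_∈ union) (sym eq) (∈union zero w)
      ... | inj₂ (_ , eq) = subst (_∈ union) (sym eq) (∈union (suc i) v)

      Reserved : Fin m → List (Fin n) → Set
      Reserved j r = r ≡ [] ⊎ ∃ λ u → u ∈ free × u ≢ w × Joins a b j w u × r ≡ σ u ∷ []

      -- For `u` in the kernel, `boundary` supplies an old hub and nothing is reserved. For free
      -- `u`, the vertex `ψ (suc i) u` lies off the core `σ`, hence off the exclusion list of the
      -- saturated pair `σ w`, `σ u`.
      moved : ∀ i j {u} → u ≢ w → Joins a b j w u → ∃ λ r → Avail t (σ w) (ψ (suc i) u) r × Reserved j r
      moved i j {u} u≢w joins with u ∈? free
      ... | no u∉ = [] , Avail-sym (robCentre (All.map (λ {h} → Live-mono {h = h} s≤t) live) u∉ a∈ (boundary (flipJoins joins) u∉ a∈) (suc i) zero) , inj₁ refl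
        where
        flipJoins : Joins a b j w u → Joins a b j u w
        flipJoins (inj₁ (x , y)) = inj₂ (y , x)
        flipJoins (inj₂ (x , y)) = inj₁ (y , x)
      ... | yes u∈ = σ u ∷ [] , Sat⇒Avail (satJoin (sat zero) joins) (core≤exclusion σ) (λ eq → u≢w (sym (ψ-inj zero eq)))
              (core-petal a∈ (λ ())) (core-petal u∈ (λ ()))
              (λ y∈ → let v , eq = MemP.∈-tabulate⁻ y∈ in petal-core u∈ (λ ()) eq) ,
              inj₂ (u , u∈ , u≢w , joins , refl)

      reserve : ∀ i j → ∃ λ r → Avail t (cross i (a j)) (cross i (b j)) r × Reserved j r
      reserve i j with cross-view i (a j) | cross-view i (b j)
      ... | inj₁ (ea , _) | inj₁ (eb , _) = contradiction (trans ea (sym eb)) (a≢b j)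
      ... | inj₁ (ea , ca) | inj₂ (nb , cb) = let r , av , res = moved i j nb (inj₁ (ea , refl)) in
              r , subst₂ (λ x y → Avail t x y r) (sym ca) (sym cb) av , res
      ... | inj₂ (na , ca) | inj₁ (eb , cb) = let r , av , res = moved i j na (inj₂ (eb , refl)) in
              r , subst₂ (λ x y → Avail t x y r) (sym ca) (sym cb) (Avail-sym av) , res
      ... | inj₂ (_ , ca) | inj₂ (_ , cb) = [] , subst₂ (λ x y → Rob t x y) (sym ca) (sym cb)
              (CoreSat⇒Rob (ψ-inj (suc i)) (sat (suc i)) j) , inj₁ refl

      reserved-∈ : ∀ {j r z} → Reserved j r → z ∈ r → ∃ λ u → u ∈ free × u ≢ w × Joins a b j w u × z ≡ σ u
      reserved-∈ (inj₁ refl) ()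
      reserved-∈ (inj₂ (u , u∈ , u≢w , joins , refl)) (here eq) = u , u∈ , u≢w , joins , eq

      reserved-≤ : ∀ {j r} → Reserved j r → length r ≤ k
      reserved-≤ (inj₁ refl) = z≤n
      reserved-≤ (inj₂ (_ , _ , _ , _ , refl)) = ℕP.<⇒≤ 2≤k

      crossHub : NewHub
      crossHub = hub , live′ , distinctHub {hub} ∉centres
        where
        b≢w : b e ≢ w
        b≢w eq = a≢b e (sym eq)
        hub : Hub
        hub = record { centre = σ w ; leaf = λ i → ψ (suc i) (b e) ; leaf-inj = leaves-inj b∈ ; excluded = union ; excluded≤ = union≤ }
        ∉centres : σ w ∉ centres
        ∉centres ∈centres with MemP.∈-map⁻ centre ∈centres
        ... | h , h∈ , eq = proj₁ (off zero a∈ h∈) eq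
        live′ : Live (suc t) hub
        live′ i {f} size x∈ y∈ out = extendCore (cross-inj i) e size (subst (_∈ₛ f) (sym (cross-here i refl)) x∈)
            (subst (_∈ₛ f) (sym (cross-else i b≢w)) y∈) core
            (λ j → proj₁ (reserve i j)) (λ j → proj₁ (proj₂ (reserve i j))) (λ j → reserved-≤ (res j))
            r-disj r-core r-f
          where
          res : ∀ j → Reserved j (proj₁ (reserve i j))
          res j = proj₂ (proj₂ (reserve i j))
          core : ∀ v → cross i v ∈ₛ f → v ≡ w ⊎ v ≡ b e
          core v v∈ with out v∈
          ... | inj₁ eq = inj₁ (cross-inj i (trans eq (sym (cross-here i refl))))
          ... | inj₂ (inj₁ eq) = inj₂ (cross-inj i (trans eq (sym (cross-else i b≢w))))
          ... | inj₂ (inj₂ v∉) = contradiction (cross∈union i v) v∉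
          -- Since `G` is simple, distinct edges at `w` have distinct other ends, so their reserved
          -- vertices `σ u` differ.
          r-disj : ∀ {j j′ z} → j ≢ j′ → z ∈ proj₁ (reserve i j) → z ∉ proj₁ (reserve i j′)
          r-disj {j} {j′} j≢j′ z∈ z∈′ with reserved-∈ (res j) z∈ | reserved-∈ (res j′) z∈′
          ... | u , _ , _ , joins , eq | u′ , _ , _ , joins′ , eq′ =
                j≢j′ (simple joins (subst (Joins a b j′ w) (ψ-inj zero (trans (sym eq′) eq)) joins′))
          r-core : ∀ j {z} v → z ∈ proj₁ (reserve i j) → z ≢ cross i v
          r-core j v z∈ z≡ with reserved-∈ (res j) z∈ | cross-view i v
          ... | u , u∈ , u≢w , _ , eq | inj₁ (_ , cv) = u≢w (ψ-inj zero (trans (sym eq) (trans z≡ cv)))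
          ... | u , u∈ , u≢w , _ , eq | inj₂ (_ , cv) = core-petal u∈ (λ ()) (trans (sym eq) (trans z≡ cv))
          r-f : ∀ j {z} → z ∈ proj₁ (reserve i j) → z ∉ₛ f
          r-f j z∈ z∈f with reserved-∈ (res j) z∈
          ... | u , u∈ , u≢w , _ , refl with out z∈f
          ... | inj₁ eq = u≢w (ψ-inj zero eq)
          ... | inj₂ (inj₁ eq) = core-petal u∈ (λ ()) eq
          ... | inj₂ (inj₂ z∉) = z∉ (∈union zero u)

    newHub : NewHub
    newHub with FinP.any? (λ j → exposed? (a j) (b j)) | FinP.any? (λ j → exposed? (b j) (a j))
      where
      exposed? : ∀ u v → Dec (u ∉ free × v ∈ free × σ u ∉ centres)
      exposed? u v = ¬? (u ∈? free) ×-dec v ∈? free ×-dec ¬? (σ u ∈? centres)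
    ... | yes (j , u∉ , v∈ , ∉centres) | _ = kernelHub (inj₁ (refl , refl)) u∉ v∈ ∉centres
    ... | no _ | yes (j , u∉ , v∈ , ∉centres) = kernelHub (inj₂ (refl , refl)) u∉ v∈ ∉centres
    ... | no hidden | no hidden′ with FinP.any? (λ j → a j ∈? free ×-dec b j ∈? free)
    ... | yes (e , a∈ , b∈) = crossHub boundary e a∈ b∈
      where
      boundary : Boundary
      boundary {j} {u} (inj₁ (refl , refl)) u∉ v∈ = decidable-stable (σ u ∈? centres) λ ∉c → hidden (j , u∉ , v∈ , ∉c)
      boundary {j} {u} (inj₂ (refl , refl)) u∉ v∈ = decidable-stable (σ u ∈? centres) λ ∉c → hidden′ (j , u∉ , v∈ , ∉c)
    -- Pairs inside the kernel are shared with `ψ zero`, which is saturated at time `s`. Mixed pairs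
    -- have an old centre at their kernel end. With no edge of `G` between free positions, `ψ o`
    -- would be robust at time `s`.
    ... | no independent = contradiction rob stuck
      where
      rob : ∀ j → Rob s (ψ o (a j)) (ψ o (b j))
      rob j with a j ∈? free | b j ∈? free
      ... | yes a∈ | yes b∈ = contradiction (j , a∈ , b∈) independent
      ... | no a∉ | no b∉ = subst₂ (Rob s) (kernel a∉ zero o) (kernel b∉ zero o) (CoreSat⇒Rob (ψ-inj zero) sat₀ j)
      ... | no a∉ | yes b∈ = robCentre live a∉ b∈ (decidable-stable (σ (a j) ∈? centres) λ ∉c → hidden (j , a∉ , b∈ , ∉c)) o o
      ... | yes a∈ | no b∉ = Avail-sym (robCentre live b∉ a∈ (decidable-stable (σ (b j) ∈? centres) λ ∉c → hidden′ (j , b∉ , a∈ , ∉c)) o o)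

  -- Epochs and the count of hubs

  zone : List Hub → List (Fin n)
  zone = concatMap λ h → centre h ∷ excluded h

  zone≤ : ∀ hs → length (zone hs) ≤ length hs * suc hubSize
  zone≤ [] = z≤n
  zone≤ (h ∷ hs) = ≤-trans (≤-reflexive (ListP.length-++ (centre h ∷ excluded h))) (+-mono-≤ (s≤s (excluded≤ h)) (zone≤ hs))

  ∈-zone : ∀ {h hs z} → h ∈ hs → z ∈ centre h ∷ excluded h → z ∈ zone hs
  ∈-zone h∈ z∈ = MemP.∈-concat⁺′ z∈ (MemP.∈-map⁺ _ h∈)

  module Epoch (t : ℕ) (new : ∀ (i : Fin epochEvents) → NewEdge k a b H (t + 4 * toℕ i))
    (hs : List Hub) (live : All (Live t) hs) (hs≤ : length hs ≤ hubCount) where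

    φ : Fin epochEvents → Fin p → Fin n
    φ i = NewEdge.vertex (new i)

    φ-inj : ∀ i → Injection (φ i)
    φ-inj i = IsCopy.inj (NewEdge.isCopy (new i))

    order : ∀ (i : Fin epochEvents) {x} → toℕ i < x → suc (3 + (t + 4 * toℕ i)) ≤ t + 4 * x
    order i {x} i<x = ≤-trans (≤-reflexive (begin
        4 + (t + 4 * toℕ i) ≡⟨ sym (+-assoc 4 t _) ⟩
        4 + t + 4 * toℕ i ≡⟨ cong (_+ 4 * toℕ i) (+-comm 4 t) ⟩
        t + 4 + 4 * toℕ i ≡⟨ +-assoc t 4 _ ⟩
        t + (4 + 4 * toℕ i) ≡⟨ cong (t +_) (sym (ℕP.*-suc 4 (toℕ i))) ⟩
        t + 4 * suc (toℕ i) ∎)) (ℕP.+-monoʳ-≤ t (ℕP.*-monoʳ-≤ 4 i<x))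
      where open ≡-Reasoning

    late : ∀ i → 3 + (t + 4 * toℕ i) ≤ t + 4 * epochEvents
    late i = ≤-trans (ℕP.n≤1+n _) (order i (FinP.toℕ<n i))

    module _ (free : List (Fin p)) (ρ : Fin (suc hubDegree) → Fin epochEvents)
      (kernel : ∀ {v} → v ∉ free → ∀ i j → φ (ρ i) v ≡ φ (ρ j) v)
      (petal : ∀ {i j v w} → i ≢ j → v ∈ free → w ∈ free → φ (ρ i) v ≢ φ (ρ j) w)
      (off : ∀ i {v} → v ∈ free → φ (ρ i) v ∉ zone hs)
      (ρ-mono : ∀ {i j} → i Fin.< j → ρ i Fin.< ρ j) where

      private
        o : Fin (suc hubDegree)
        -- Petal 1: any petal other than petal 0 comes from a later event.
        o = suc (Fin.fromℕ< (≤-trans (s≤s z≤n) hubDegree≥))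

      hubFromPetals : ∃ λ h → Live (suc (t + 4 * epochEvents)) h × All (Distinct h) hs
      hubFromPetals = newHub (late (ρ zero)) hs (All.map (λ {h} → Live-mono {h = h} (≤-trans (ℕP.m≤m+n t _) (ℕP.m≤n+m _ 3))) live)
        (φ ∘ ρ) (φ-inj ∘ ρ) free kernel petal
        (λ i v∈ h∈ → (λ eq → off i v∈ (∈-zone h∈ (here eq))) , (λ z∈ → off i v∈ (∈-zone h∈ (there z∈))))
        (λ i j → Sat-mono (late (ρ i)) (newEdge⇒CoreSat (new (ρ i)) j))
        (newEdge⇒CoreSat (new (ρ zero))) o
        -- If the pairs of this core were robust three steps after event `ρ zero`, the core would be
        -- saturated one step later. By the spacing of four this is no later than event `ρ o`, whose
        -- new edge is still absent then.
        (λ rob → newEdge-late (new (ρ o)) (Rob⇒CoreSat (φ-inj (ρ o)) rob) (order (ρ zero) (ρ-mono {zero} {o} (s≤s z≤n))))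

    epoch : ∃ λ h → Live (suc (t + 4 * epochEvents)) h × All (Distinct h) hs
    epoch = let free , ρ , kernel , petal , off , ρ-mono =
                  petals φ (suc hubDegree) (zone hs) (≤-trans (zone≤ hs) (ℕP.*-monoˡ-≤ (suc hubSize) hs≤)) epochEvents≥
            in hubFromPetals free ρ kernel petal off ρ-mono

  module _ (new : ∀ t → t ≤ runningTime → NewEdge k a b H t) where

    HubsAt : ℕ → Set
    HubsAt r = ∃ λ hs → length hs ≡ r × All (Live (r * epochLength)) hs × AllPairs Distinct hs

    nextHub : ∀ {r} → r < hubCount → HubsAt r → HubsAt (suc r)
    nextHub {r} r< (hs , len , live , distinct) =
      let h , live-h , distinct-h = Epoch.epoch (r * epochLength) (λ i → new _ (inTime i)) hs live (≤-trans (≤-reflexive len) (ℕP.<⇒≤ r<))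
      in h ∷ hs , cong suc len ,
         subst (λ t → Live t h) time live-h ∷ All.map (λ {h} → Live-mono {h = h} (ℕP.m≤n+m (r * epochLength) epochLength)) live ,
         distinct-h ∷ distinct
      where
      time : suc (r * epochLength + 4 * epochEvents) ≡ suc r * epochLength
      time = trans (sym (+-suc (r * epochLength) (4 * epochEvents)))
        (trans (cong (r * epochLength +_) (sym epochLength≡)) (+-comm (r * epochLength) epochLength))
      inTime : ∀ (i : Fin epochEvents) → r * epochLength + 4 * toℕ i ≤ runningTime
      inTime i = begin
        r * epochLength + 4 * toℕ i ≤⟨ ℕP.+-monoʳ-≤ (r * epochLength) (ℕP.*-monoʳ-≤ 4 (ℕP.<⇒≤ (FinP.toℕ<n i))) ⟩
        r * epochLength + 4 * epochEvents ≤⟨ ℕP.n≤1+n _ ⟩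
        suc (r * epochLength + 4 * epochEvents) ≡⟨ time ⟩
        suc r * epochLength ≤⟨ ℕP.*-monoˡ-≤ epochLength r< ⟩
        hubCount * epochLength ≤⟨ ℕP.m≤n+m _ 4 ⟩
        4 + hubCount * epochLength ≡⟨ sym runningTime≡ ⟩
        runningTime ∎
        where open ℕP.≤-Reasoning

    manyHubs : ∀ r → r ≤ hubCount → HubsAt r
    manyHubs zero _ = [] , refl , [] , []
    manyHubs (suc r) r< = nextHub r< (manyHubs r (ℕP.<⇒≤ r<))

    finished : ∀ {t} hs → hubCount ≤ length hs → All (Live t) hs → AllPairs Distinct hs → Fin m →
      ∀ {f} → ∣ f ∣ ≡ k → H (4 + t) f
    finished hs len live distinct j =
      let X , X∈ , separate = separateHubs hs distinct len
      in everything j X (λ i → All.lookup live (X∈ i)) (centre-inj X (proj₁ ∘ separate)) (λ i≢i′ → proj₂ (proj₂ (separate i≢i′)))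
      where
      centre-inj : ∀ (X : Fin poolSize → Hub) → (∀ {i i′} → i ≢ i′ → Distinct (X i) (X i′)) → Injection (centre ∘ X)
      centre-inj X distinctX {i} {i′} eq with i FinP.≟ i′
      ... | yes i≡i′ = i≡i′
      ... | no i≢i′ = contradiction eq (distinctX i≢i′)

    -- The new edge at time `runningTime` is a `k`-set still absent when all of them are already
    -- present. Its `label` also provides the edge of `G` needed to place copies on the pool.
    notAlwaysNew : Data.Empty.⊥
    notAlwaysNew =
      let hs , len , live , distinct = manyHubs hubCount ≤-refl
      in absent (subst (λ t → H t (edge label)) (sym runningTime≡)
           (finished hs (≤-reflexive (sym len)) live distinct label (IsCopy.size isCopy label)))
      where open NewEdge (new runningTime ≤-refl)

-- Reflection of the Boolean definitions

∧-true⁻ : ∀ {x y} → x ∧ y ≡ true → x ≡ true × y ≡ true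
∧-true⁻ {true} {true} _ = refl , refl

∧-true⁺ : ∀ {x y} → x ≡ true → y ≡ true → x ∧ y ≡ true
∧-true⁺ refl refl = refl

∨-true⁻ : ∀ {x y} → x ∨ y ≡ true → x ≡ true ⊎ y ≡ true
∨-true⁻ {true} _ = inj₁ refl
∨-true⁻ {false} e = inj₂ e

∨-true⁺ˡ : ∀ {x y} → x ≡ true → x ∨ y ≡ true
∨-true⁺ˡ refl = refl

∨-true⁺ʳ : ∀ {x y} → y ≡ true → x ∨ y ≡ true
∨-true⁺ʳ {x} refl = BoolP.∨-zeroʳ x

imp⁻ : ∀ {x y} → not x ∨ y ≡ true → x ≡ true → y ≡ true
imp⁻ e refl = e

imp⁺ : ∀ {x y} → (x ≡ true → y ≡ true) → not x ∨ y ≡ true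
imp⁺ {false} f = refl
imp⁺ {true} f = f refl

conv⁻ : ∀ {x y} → x ∨ not y ≡ true → y ≡ true → x ≡ true
conv⁻ {true} e _ = refl
conv⁻ {false} () refl

conv⁺ : ∀ {x y} → (y ≡ true → x ≡ true) → x ∨ not y ≡ true
conv⁺ {true} f = refl
conv⁺ {false} {true} f = f refl
conv⁺ {false} {false} f = refl

does-true⁻ : {A : Set} (A? : Dec A) → does A? ≡ true → A
does-true⁻ (yes a) _ = a

does-true⁺ : {A : Set} (A? : Dec A) → A → does A? ≡ true
does-true⁺ (yes _) _ = refl
does-true⁺ (no ¬a) a = contradiction a ¬a

_≟S_ : {n : ℕ} (S T : Subset n) → Dec (S ≡ T)
_≟S_ = VecP.≡-dec BoolP._≟_

module _ {A : Set} (q : A → Bool) where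

  anyL⁻ : ∀ xs → anyL q xs ≡ true → ∃ λ x → x ∈ xs × q x ≡ true
  anyL⁻ (x ∷ xs) e with ∨-true⁻ {q x} e
  ... | inj₁ qx = x , here refl , qx
  ... | inj₂ e′ = let y , y∈ , qy = anyL⁻ xs e′ in y , there y∈ , qy

  anyL⁺ : ∀ {x xs} → x ∈ xs → q x ≡ true → anyL q xs ≡ true
  anyL⁺ (here refl) qx = ∨-true⁺ˡ qx
  anyL⁺ {xs = y ∷ _} (there x∈) qx = ∨-true⁺ʳ {q y} (anyL⁺ x∈ qx)

  allL⁻ : ∀ {x} xs → allL q xs ≡ true → x ∈ xs → q x ≡ true
  allL⁻ (y ∷ _) e (here refl) = proj₁ (∧-true⁻ {q y} e)
  allL⁻ (y ∷ xs) e (there x∈) = allL⁻ xs (proj₂ (∧-true⁻ {q y} e)) x∈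

  allL⁺ : ∀ xs → (∀ {x} → x ∈ xs → q x ≡ true) → allL q xs ≡ true
  allL⁺ [] _ = refl
  allL⁺ (x ∷ xs) f = ∧-true⁺ (f (here refl)) (allL⁺ xs (f ∘ there))

memS⁻ : {n : ℕ} {S : Subset n} {D : List (Subset n)} → memS S D ≡ true → S ∈ D
memS⁻ {S = S} {D} e with anyL⁻ (S ==S_) D e
... | T , T∈ , S≡T = subst (_∈ _) (sym (does-true⁻ (S ≟S T) S≡T)) T∈

memS⁺ : {n : ℕ} {S : Subset n} {D : List (Subset n)} → S ∈ D → memS S D ≡ true
memS⁺ {S = S} S∈ = anyL⁺ (S ==S_) S∈ (does-true⁺ (S ≟S S) refl)

∈-allSubsets : {n : ℕ} (S : Subset n) → S ∈ allSubsets n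
∈-allSubsets [] = here refl
∈-allSubsets (true ∷ S) = MemP.∈-++⁺ˡ (MemP.∈-map⁺ (true ∷_) (∈-allSubsets S))
∈-allSubsets {suc n} (false ∷ S) = MemP.∈-++⁺ʳ (map (true ∷_) (allSubsets n)) (MemP.∈-map⁺ (false ∷_) (∈-allSubsets S))

length-allSubsets : ∀ n → length (allSubsets n) ≡ 2 ^ n
length-allSubsets zero = refl
length-allSubsets (suc n) = trans (ListP.length-++ (map (true ∷_) (allSubsets n)))
  (cong₂ _+_ (trans (ListP.length-map _ (allSubsets n)) (length-allSubsets n))
    (trans (ListP.length-map _ (allSubsets n)) (trans (length-allSubsets n) (sym (ℕP.+-identityʳ (2 ^ n))))))

allSubsets-unique : ∀ n → Unique (allSubsets n)
allSubsets-unique zero = [] ∷ []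
allSubsets-unique (suc n) = UniqueP.++⁺ (UniqueP.map⁺ VecP.∷-injectiveʳ (allSubsets-unique n))
  (UniqueP.map⁺ VecP.∷-injectiveʳ (allSubsets-unique n)) disjoint
  where
  disjoint : ∀ {S} → ¬ (S ∈ map (true ∷_) (allSubsets n) × S ∈ map (false ∷_) (allSubsets n))
  disjoint (t∈ , f∈) with MemP.∈-map⁻ (true ∷_) t∈ | MemP.∈-map⁻ (false ∷_) f∈
  ... | _ , _ , refl | _ , _ , ()

∈-allMaps : {m n : ℕ} (φ : Vec (Fin n) m) → φ ∈ allMaps m n
∈-allMaps [] = here refl
∈-allMaps {suc m} {n} (x ∷ φ) = MemP.∈-concat⁺′ (MemP.∈-map⁺ (x ∷_) (∈-allMaps φ))
  (MemP.∈-map⁺ (λ x → map (x ∷_) (allMaps m n)) (MemP.∈-allFin x))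

module _ {n : ℕ} {E : Subset n → Bool} where

  ∈-edgeList⁺ : ∀ {S} → E S ≡ true → S ∈ edgeList E
  ∈-edgeList⁺ {S} = MemP.∈-filter⁺ (λ S → E S BoolP.≟ true) (∈-allSubsets S)

  ∈-edgeList⁻ : ∀ {S} → S ∈ edgeList E → E S ≡ true
  ∈-edgeList⁻ S∈ = proj₂ (MemP.∈-filter⁻ (λ S → E S BoolP.≟ true) {xs = allSubsets n} S∈)

  edgeList-unique : Unique (edgeList E)
  edgeList-unique = UniqueP.filter⁺ (λ S → E S BoolP.≟ true) (allSubsets-unique n)

lookup-anyV⁻ : {m n : ℕ} (S : Subset m) (φ : Vec (Fin n) m) {y : Fin n} →
  anyV (Vec.zipWith (λ b x → b ∧ (x ==F y)) S φ) ≡ true → ∃ λ x → x ∈ₛ S × Vec.lookup φ x ≡ y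
lookup-anyV⁻ [] [] ()
lookup-anyV⁻ (s ∷ S) (z ∷ φ) {y} e with ∨-true⁻ {s ∧ (z ==F y)} e
... | inj₁ e′ with ∧-true⁻ {s} e′
... | refl , z≡y = zero , Vec.here , does-true⁻ (z FinP.≟ y) z≡y
lookup-anyV⁻ (s ∷ S) (z ∷ φ) e | inj₂ e′ = let x , x∈ , eq = lookup-anyV⁻ S φ e′ in suc x , Vec.there x∈ , eq

lookup-anyV⁺ : {m n : ℕ} {S : Subset m} (φ : Vec (Fin n) m) {x : Fin m} → x ∈ₛ S →
  anyV (Vec.zipWith (λ b x′ → b ∧ (x′ ==F Vec.lookup φ x)) S φ) ≡ true
lookup-anyV⁺ (z ∷ φ) Vec.here = ∨-true⁺ˡ (does-true⁺ (z FinP.≟ z) refl)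
lookup-anyV⁺ {S = s ∷ S} (z ∷ φ) {suc x} (Vec.there x∈) = ∨-true⁺ʳ {s ∧ (z ==F Vec.lookup φ x)} (lookup-anyV⁺ φ x∈)

module _ {m n : ℕ} (φ : Vec (Fin n) m) where

  ∈-image⁻ : ∀ {S y} → y ∈ₛ image φ S → ∃ λ x → x ∈ₛ S × Vec.lookup φ x ≡ y
  ∈-image⁻ {S} {y} y∈ = lookup-anyV⁻ S φ (trans (sym (VecP.lookup∘tabulate _ y)) (VecP.[]=⇒lookup y∈))

  ∈-image⁺ : ∀ {S x} → x ∈ₛ S → Vec.lookup φ x ∈ₛ image φ S
  ∈-image⁺ x∈ = VecP.lookup⇒[]= _ _ (trans (VecP.lookup∘tabulate _ (Vec.lookup φ _)) (lookup-anyV⁺ φ x∈))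

  private
    apart : Fin m → Fin m → Bool
    apart i j = (i ==F j) ∨ not (Vec.lookup φ i ==F Vec.lookup φ j)

  injectiveB⁻ : injectiveB φ ≡ true → Injection (Vec.lookup φ)
  injectiveB⁻ e {i} {j} eq with ∨-true⁻ {i ==F j} (allL⁻ (apart i) (allFin m) (allL⁻ (λ i → allL (apart i) (allFin m)) (allFin m) e (MemP.∈-allFin i)) (MemP.∈-allFin j))
  ... | inj₁ i≡j = does-true⁻ (i FinP.≟ j) i≡j
  ... | inj₂ ne with Vec.lookup φ i FinP.≟ Vec.lookup φ j
  ...   | no ¬eq = contradiction eq ¬eq

  injectiveB⁺ : Injection (Vec.lookup φ) → injectiveB φ ≡ true
  injectiveB⁺ inj = allL⁺ (λ i → allL (apart i) (allFin m)) (allFin m) λ {i} _ → allL⁺ (apart i) (allFin m) λ {j} _ →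
    conv⁺ {i ==F j} (λ e → does-true⁺ (i FinP.≟ j) (inj (does-true⁻ (Vec.lookup φ i FinP.≟ Vec.lookup φ j) e)))

  image-injective : Injection (Vec.lookup φ) → Injection (image φ)
  image-injective inj {S} {T} eq = SubP.⊆-antisym (sub eq) (sub (sym eq))
    where
    sub : ∀ {S T} → image φ S ≡ image φ T → ∀ {x} → x ∈ₛ S → x ∈ₛ T
    sub {S} {T} eq {x} x∈ with ∈-image⁻ (subst (Vec.lookup φ x ∈ₛ_) eq (∈-image⁺ {S} x∈))
    ... | y , y∈ , e = subst (_∈ₛ T) (inj e) y∈

module _ {A : Set} where

  sublists⇒⊆ : ∀ {D : List A} ys → D ∈ sublists ys → D ⊆ ys
  sublists⇒⊆ [] (here refl) = []
  sublists⇒⊆ (y ∷ ys) D∈ with MemP.∈-++⁻ (map (y ∷_) (sublists ys)) D∈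
  ... | inj₂ D∈′ = y ∷ʳ sublists⇒⊆ ys D∈′
  ... | inj₁ D∈′ with MemP.∈-map⁻ (y ∷_) D∈′
  ... | D′ , D′∈ , refl = refl ∷ sublists⇒⊆ ys D′∈

  ⊆⇒sublists : ∀ {D ys : List A} → D ⊆ ys → D ∈ sublists ys
  ⊆⇒sublists [] = here refl
  ⊆⇒sublists {ys = y ∷ ys} (.y ∷ʳ s) = MemP.∈-++⁺ʳ (map (y ∷_) (sublists ys)) (⊆⇒sublists s)
  ⊆⇒sublists {ys = y ∷ ys} (refl ∷ s) = MemP.∈-++⁺ˡ (MemP.∈-map⁺ (y ∷_) (⊆⇒sublists s))

  module _ {P Q : Pred A 0ℓ} (P? : Decidable P) (Q? : Decidable Q) where

    filter-comm : ∀ xs → filter P? (filter Q? xs) ≡ filter Q? (filter P? xs)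
    filter-comm [] = refl
    filter-comm (x ∷ xs) with does (Q? x) in qx | does (P? x) in px
    ... | true | true rewrite qx | px = cong (x ∷_) (filter-comm xs)
    ... | true | false rewrite px = filter-comm xs
    ... | false | true rewrite qx = filter-comm xs
    ... | false | false = filter-comm xs

    filter-filter : {R : Pred A 0ℓ} (R? : Decidable R) → (∀ {x} → R x → P x × Q x) → (∀ {x} → P x → Q x → R x) →
      ∀ xs → filter P? (filter Q? xs) ≡ filter R? xs
    filter-filter R? to from [] = refl
    filter-filter R? to from (x ∷ xs) with Q? x | R? x
    ... | yes q | yes r = trans (ListP.filter-accept P? (proj₁ (to r))) (cong (x ∷_) (filter-filter R? to from xs))
    ... | yes q | no ¬r = trans (ListP.filter-reject P? (λ p → ¬r (from p q))) (filter-filter R? to from xs)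
    ... | no ¬q | yes r = contradiction (proj₂ (to r)) ¬q
    ... | no ¬q | no ¬r = filter-filter R? to from xs

module _ {A B : Set} {P : Pred B 0ℓ} (P? : Decidable P) where

  filter-map : {Q : Pred A 0ℓ} (Q? : Decidable Q) (g : A → B) → (∀ {x} → P (g x) → Q x) → (∀ {x} → Q x → P (g x)) →
    ∀ xs → filter P? (map g xs) ≡ map g (filter Q? xs)
  filter-map Q? g to from [] = refl
  filter-map Q? g to from (x ∷ xs) with Q? x
  ... | yes q = trans (ListP.filter-accept P? (from q)) (cong (g x ∷_) (filter-map Q? g to from xs))
  ... | no ¬q = trans (ListP.filter-reject P? (¬q ∘ to)) (filter-map Q? g to from xs)

filter-cartesianProduct : {A B : Set} {P : Pred B 0ℓ} (P? : Decidable P) (xs : List A) (ys : List B) →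
  filter (P? ∘ proj₂) (cartesianProduct xs ys) ≡ cartesianProduct xs (filter P? ys)
filter-cartesianProduct P? [] ys = refl
filter-cartesianProduct P? (x ∷ xs) ys = trans (ListP.filter-++ (P? ∘ proj₂) (map (x ,_) ys) _)
  (cong₂ _++_ (filter-map (P? ∘ proj₂) P? (x ,_) id id ys) (filter-cartesianProduct P? xs ys))

module _ {n : ℕ} (f : Subset n) where

  open import Data.List.Membership.DecPropositional (_≟S_ {n}) using () renaming (_∈?_ to _∈L?_)

  contains? : (D : List (Subset n)) → Dec (f ∈ D)
  contains? D = f ∈L? D

  filter-sublists : ∀ ys → filter (¬? ∘ contains?) (sublists ys) ≡ sublists (filter (¬? ∘ (f ≟S_)) ys)
  filter-sublists [] = refl
  filter-sublists (y ∷ ys) with f ≟S y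
  ... | yes refl = trans (ListP.filter-++ (¬? ∘ contains?) (map (f ∷_) (sublists ys)) (sublists ys))
        (trans (cong (_++ filter (¬? ∘ contains?) (sublists ys))
          (ListP.filter-none (¬? ∘ contains?) {xs = map (f ∷_) (sublists ys)} (AllP.map⁺ (All.tabulate λ _ ¬∈ → ¬∈ (here refl)))))
          (filter-sublists ys))
  ... | no f≢y = trans (ListP.filter-++ (¬? ∘ contains?) (map (y ∷_) (sublists ys)) (sublists ys))
        (cong₂ _++_ (trans (filter-map (¬? ∘ contains?) (¬? ∘ contains?) (y ∷_) (λ ¬∈ ∈D → ¬∈ (there ∈D))
            (λ { ¬∈ (here e) → f≢y e ; ¬∈ (there ∈D) → ¬∈ ∈D }) (sublists ys))
          (cong (map (y ∷_)) (filter-sublists ys))) (filter-sublists ys))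

-- When an added edge increases the number of copies

module _ (F : HG) {n : ℕ} where

  isCopy : Subset n × List (Subset n) → Bool
  isCopy (W , D) = insideB W D ∧ isoB F W D

  isCopy? : ∀ WD → Dec (isCopy WD ≡ true)
  isCopy? WD = isCopy WD BoolP.≟ true

  private
    module _ (W : Subset n) (D : List (Subset n)) where

      inside? : Subset n → Fin n → Bool
      inside? T x = not (Vec.lookup T x) ∨ Vec.lookup W x

      preserves reflects : Vec (Fin n) (N F) → Subset (N F) → Bool
      preserves φ S = not (E F S) ∨ memS (image φ S) D
      reflects φ S = E F S ∨ not (memS (image φ S) D)

      isIso : Vec (Fin n) (N F) → Bool
      isIso φ = injectiveB φ ∧ (image φ ⊤ ==S W) ∧ allL (preserves φ) (allSubsets (N F)) ∧ allL (reflects φ) (allSubsets (N F))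

  module _ (EH : Subset n → Bool) (f : Subset n) (f∉ : EH f ≡ false) where

    private
      candidates : List (Subset n × List (Subset n))
      candidates = cartesianProduct (allSubsets n) (sublists (edgeList (addEdge EH f)))

    -- The double negation is the rejected half in `length-filter-split`, where the test is that `f`
    -- is not listed.
    usesEdge : List (Subset n × List (Subset n))
    usesEdge = filter (¬? ∘ ¬? ∘ contains? f ∘ proj₂) (filter isCopy? candidates)

    edgeList-remove : filter (¬? ∘ (f ≟S_)) (edgeList (addEdge EH f)) ≡ edgeList EH
    edgeList-remove = filter-filter (¬? ∘ (f ≟S_)) (λ S → addEdge EH f S BoolP.≟ true) (λ S → EH S BoolP.≟ true)
      (λ {S} S∈ → (λ { refl → contradiction (trans (sym f∉) S∈) λ () }) , ∨-true⁺ˡ S∈)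
      (λ {S} f≢S S∈ → [ id , (λ e → contradiction (sym (does-true⁻ (S ≟S f) e)) f≢S) ]′ (∨-true⁻ {EH S} S∈))
      (allSubsets n)

    -- Being a copy depends only on the candidate `(W , D)`. The candidates that do not list `f` are
    -- exactly those of the smaller hypergraph, so the surplus consists of the copies through `f`.
    copies-addEdge : copies F (addEdge EH f) ≡ copies F EH + length usesEdge
    copies-addEdge = trans (sym (length-filter-split (¬? ∘ contains? f ∘ proj₂) (filter isCopy? candidates)))
      (cong (_+ length usesEdge) (cong length (begin
        filter (¬? ∘ contains? f ∘ proj₂) (filter isCopy? candidates)
          ≡⟨ filter-comm (¬? ∘ contains? f ∘ proj₂) isCopy? candidates ⟩
        filter isCopy? (filter (¬? ∘ contains? f ∘ proj₂) candidates)
          ≡⟨ cong (filter isCopy?) (filter-cartesianProduct (¬? ∘ contains? f) (allSubsets n) _) ⟩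
        filter isCopy? (cartesianProduct (allSubsets n) (filter (¬? ∘ contains? f) (sublists (edgeList (addEdge EH f)))))
          ≡⟨ cong (λ Ds → filter isCopy? (cartesianProduct (allSubsets n) Ds))
               (trans (filter-sublists f (edgeList (addEdge EH f))) (cong sublists edgeList-remove)) ⟩
        filter isCopy? (cartesianProduct (allSubsets n) (sublists (edgeList EH))) ∎)))
      where open ≡-Reasoning

    record Embedding : Set where
      field
        φ       : Vec (Fin n) (N F)
        φ-inj   : Injection (Vec.lookup φ)
        maps    : ∀ {S} → E F S ≡ true → addEdge EH f (image φ S) ≡ true
        source  : Subset (N F)
        source∈ : E F source ≡ true
        hits    : image φ source ≡ f

    copies⁻ : copies F EH < copies F (addEdge EH f) → Embedding
    copies⁻ lt with usesEdge in eq
    ... | [] = contradiction lt (ℕP.<-irrefl (sym (trans copies-addEdge (trans (cong (λ l → copies F EH + length l) eq) (ℕP.+-identityʳ _)))))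
    ... | (W , D) ∷ _
      with MemP.∈-filter⁻ (¬? ∘ ¬? ∘ contains? f ∘ proj₂) {xs = filter isCopy? candidates} (subst ((W , D) ∈_) (sym eq) (here refl))
    ... | WD∈′ , ¬¬f∈D with MemP.∈-filter⁻ isCopy? {xs = candidates} WD∈′
    ... | WD∈ , copy with ∧-true⁻ {insideB W D} copy
    ... | within , iso with anyL⁻ (isIso W D) (allMaps (N F) n) iso
    ... | φ , _ , ok with ∧-true⁻ {injectiveB φ} ok
    ... | inj , ok′ with ∧-true⁻ {image φ ⊤ ==S W} ok′
    ... | onto , ok″ with ∧-true⁻ {allL (preserves W D φ) (allSubsets (N F))} ok″
    ... | edges , nonedges = record
      { φ = φ
      ; φ-inj = injectiveB⁻ φ inj
      ; maps = λ {S} S∈ → ∈-edgeList⁻ (SublistP.Any-resp-⊆ D⊆ (memS⁻ (imp⁻ {E F S} (allL⁻ (preserves W D φ) (allSubsets (N F)) edges (∈-allSubsets S)) S∈)))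
      ; source = source
      ; source∈ = conv⁻ {E F source} (allL⁻ (reflects W D φ) (allSubsets (N F)) nonedges (∈-allSubsets source)) (memS⁺ (subst (_∈ D) (sym hits) f∈D))
      ; hits = hits
      }
      where
      f∈D : f ∈ D
      f∈D = decidable-stable (contains? f D) ¬¬f∈D
      D⊆ : D ⊆ edgeList (addEdge EH f)
      D⊆ = sublists⇒⊆ _ (proj₂ (MemP.∈-cartesianProduct⁻ (allSubsets n) _ WD∈))
      -- The preimage of `f`. Its image is all of `f` because `insideB` keeps `f` within `W`, the
      -- image of `φ`; the clause `reflects` then makes it an edge of `F`.
      source : Subset (N F)
      source = Vec.tabulate λ x → Vec.lookup f (Vec.lookup φ x)
      hits : image φ source ≡ f
      hits = SubP.⊆-antisym to from
        where
        to : ∀ {y} → y ∈ₛ image φ source → y ∈ₛ f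
        to y∈ with ∈-image⁻ φ {source} y∈
        ... | x , x∈ , refl = VecP.lookup⇒[]= _ f (trans (sym (VecP.lookup∘tabulate _ x)) (VecP.[]=⇒lookup x∈))
        from : ∀ {y} → y ∈ₛ f → y ∈ₛ image φ source
        from {y} y∈ with ∈-image⁻ φ {⊤} (subst (y ∈ₛ_) (sym (does-true⁻ (image φ ⊤ ≟S W) onto))
                          (VecP.lookup⇒[]= y W (imp⁻ {Vec.lookup f y} (allL⁻ (inside? W D f) (allFin n) (allL⁻ (λ T → allL (inside? W D T) (allFin n)) D within f∈D) (MemP.∈-allFin y)) (VecP.[]=⇒lookup y∈))))
        ... | x , _ , refl = ∈-image⁺ φ {source} (VecP.lookup⇒[]= x source (trans (VecP.lookup∘tabulate _ x) (VecP.[]=⇒lookup y∈)))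

    copies⁺ : Embedding → copies F EH < copies F (addEdge EH f)
    copies⁺ emb = subst (copies F EH <_) (sym copies-addEdge) (ℕP.m<m+n (copies F EH) (MemP.∈-length WD∈))
      where
      open Embedding emb
      onto : Subset n → Subset (N F) → Bool
      onto T S = E F S ∧ (image φ S ==S T)
      covers : Subset n → Bool
      covers T = anyL (onto T) (allSubsets (N F))
      covers? : ∀ T → Dec (covers T ≡ true)
      covers? T = covers T BoolP.≟ true
      W : Subset n
      W = image φ ⊤
      -- Filtered from the edge list instead of collected from the images, so that it is literally
      -- one of the sublists that `copies` runs through.
      D : List (Subset n)
      D = filter covers? (edgeList (addEdge EH f))
      ∈D⁺ : ∀ {S} → E F S ≡ true → image φ S ∈ D
      ∈D⁺ {S} S∈ = MemP.∈-filter⁺ covers? (∈-edgeList⁺ (maps S∈)) (anyL⁺ (onto (image φ S)) (∈-allSubsets S) (∧-true⁺ S∈ (does-true⁺ (image φ S ≟S image φ S) refl)))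
      ∈D⁻ : ∀ {T} → T ∈ D → ∃ λ S → E F S ≡ true × image φ S ≡ T
      ∈D⁻ {T} T∈ with anyL⁻ (onto T) (allSubsets (N F)) (proj₂ (MemP.∈-filter⁻ covers? {xs = edgeList (addEdge EH f)} T∈))
      ... | S , _ , e = S , proj₁ (∧-true⁻ {E F S} e) , does-true⁻ (image φ S ≟S T) (proj₂ (∧-true⁻ {E F S} e))
      within : insideB W D ≡ true
      within = allL⁺ (λ T → allL (inside? W D T) (allFin n)) D λ {T} T∈ → allL⁺ (inside? W D T) (allFin n) λ {x} _ → imp⁺ {Vec.lookup T x} λ x∈ → inW T∈ (VecP.lookup⇒[]= x T x∈)
        where
        inW : ∀ {T x} → T ∈ D → x ∈ₛ T → Vec.lookup W x ≡ true
        inW T∈ x∈ with ∈D⁻ T∈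
        ... | S , _ , refl with ∈-image⁻ φ {S} x∈
        ... | y , _ , refl = VecP.[]=⇒lookup (∈-image⁺ φ {⊤} SubP.∈⊤)
      nonedge : ∀ S → memS (image φ S) D ≡ true → E F S ≡ true
      nonedge S e with ∈D⁻ (memS⁻ e)
      ... | S′ , S′∈ , eq = subst (λ S → E F S ≡ true) (image-injective φ φ-inj eq) S′∈
      iso : isoB F W D ≡ true
      iso = anyL⁺ (isIso W D) (∈-allMaps φ) (∧-true⁺ (injectiveB⁺ φ φ-inj) (∧-true⁺ (does-true⁺ (image φ ⊤ ≟S W) refl)
        (∧-true⁺ (allL⁺ (preserves W D φ) (allSubsets (N F)) λ {S} _ → imp⁺ {E F S} (memS⁺ ∘ ∈D⁺)) (allL⁺ (reflects W D φ) (allSubsets (N F)) λ {S} _ → conv⁺ {E F S} (nonedge S)))))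
      WD∈ : (W , D) ∈ usesEdge
      WD∈ = MemP.∈-filter⁺ (¬? ∘ ¬? ∘ contains? f ∘ proj₂)
        (MemP.∈-filter⁺ isCopy? (MemP.∈-cartesianProduct⁺ (∈-allSubsets W) (⊆⇒sublists (SublistP.filter-⊆ covers? (edgeList (addEdge EH f))))) (∧-true⁺ within iso))
        (λ ¬f∈D → ¬f∈D (subst (_∈ D) hits (∈D⁺ source∈)))

monotone-≡ : ∀ {x y} → (x ≡ true → y ≡ true) → ¬ (x ≡ false × y ≡ true) → x ≡ y
monotone-≡ {true} up _ = sym (up refl)
monotone-≡ {false} {false} _ _ = refl
monotone-≡ {false} {true} _ none = contradiction (refl , refl) none

-- Embeddings of the extension as cores with private vertices

remove : {n : ℕ} → Fin n → Subset n → Subset n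
remove z f = f Vec.[ z ]≔ outside

∣remove∣ : {n : ℕ} {z : Fin n} {f : Subset n} → z ∈ₛ f → suc ∣ remove z f ∣ ≡ ∣ f ∣
∣remove∣ {f = true ∷ f} Vec.here = refl
∣remove∣ {f = true ∷ f} (Vec.there z∈) = cong suc (∣remove∣ z∈)
∣remove∣ {f = false ∷ f} (Vec.there z∈) = ∣remove∣ z∈

∈-remove⁺ : {n : ℕ} {z w : Fin n} {f : Subset n} → w ≢ z → w ∈ₛ f → w ∈ₛ remove z f
∈-remove⁺ {z = z} {w} {f} w≢z w∈ = VecP.lookup⇒[]= w _ (trans (VecP.lookup∘updateAt′ w z w≢z f) (VecP.[]=⇒lookup w∈))

∈-remove⁻ : {n : ℕ} {z w : Fin n} {f : Subset n} → w ∈ₛ remove z f → w ≢ z × w ∈ₛ f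
∈-remove⁻ {z = z} {w} {f} w∈ = w≢z , VecP.lookup⇒[]= w f (trans (sym (VecP.lookup∘updateAt′ w z w≢z f)) (VecP.[]=⇒lookup w∈))
  where
  w≢z : w ≢ z
  w≢z refl = contradiction (trans (sym (VecP.[]=⇒lookup w∈)) (VecP.lookup∘updateAt w f)) λ ()

record Enumeration {n : ℕ} (r : ℕ) (f : Subset n) : Set where
  field
    at     : Fin r → Fin n
    at-inj : Injection at
    at∈    : ∀ i → at i ∈ₛ f
    onto   : ∀ {z} → z ∈ₛ f → ∃ λ i → at i ≡ z

enumerate : {n : ℕ} (f : Subset n) → Enumeration ∣ f ∣ f
enumerate f = subst (λ r → Enumeration r f) (length-elems f) record
  { at = lookup (elems f)
  ; at-inj = lookup-injective (elems-unique f)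
  ; at∈ = λ i → ∈-elems⁻ (MemP.∈-lookup i)
  ; onto = λ z∈ → Any.index (∈-elems⁺ z∈) , sym (AnyP.lookup-index (∈-elems⁺ z∈))
  }

enumerateRest : {n k : ℕ} {f : Subset n} {x y : Fin n} → ∣ f ∣ ≡ k → x ≢ y → x ∈ₛ f → y ∈ₛ f →
  Enumeration (k ∸ 2) (remove y (remove x f))
enumerateRest {f = f} {x} {y} size x≢y x∈ y∈ = subst (λ r → Enumeration r (remove y (remove x f)))
  (cong (_∸ 2) (trans (cong suc (∣remove∣ (∈-remove⁺ (x≢y ∘ sym) y∈))) (trans (∣remove∣ x∈) size)))
  (enumerate (remove y (remove x f)))

record Pair {n : ℕ} (f : Subset n) : Set where
  field
    fst snd : Fin n
    distinct : fst ≢ snd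
    fst∈ : fst ∈ₛ f
    snd∈ : snd ∈ₛ f
    only : ∀ {v} → v ∈ₛ f → v ≡ fst ⊎ v ≡ snd

pairOf : {n : ℕ} (f : Subset n) → ∣ f ∣ ≡ 2 → Pair f
pairOf f size = fromEnumeration (subst (λ r → Enumeration r f) size (enumerate f))
  where
  fromEnumeration : Enumeration 2 f → Pair f
  fromEnumeration en = record
    { fst = at zero ; snd = at (suc zero) ; distinct = λ e → contradiction (at-inj e) λ ()
    ; fst∈ = at∈ zero ; snd∈ = at∈ (suc zero)
    ; only = λ v∈ → case onto v∈ of λ { (zero , e) → inj₁ (sym e) ; (suc zero , e) → inj₂ (sym e) } }
    where open Enumeration en

module Extension (k : ℕ) (3≤k : 3 ≤ k) (G : Graph) where

  private
    g : HG
    g = proj₁ G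

    es : List (Subset (N g))
    es = edgeList (E g)

    m : ℕ
    m = length es

    F : HG
    F = extension k g

  ends : ∀ j → Pair (lookup es j)
  ends j = pairOf (lookup es j) (proj₂ G (lookup es j) (∈-edgeList⁻ {E = E g} (MemP.∈-lookup {xs = es} j)))

  a b : Fin m → Fin (N g)
  a j = Pair.fst (ends j)
  b j = Pair.snd (ends j)

  a≢b : ∀ j → a j ≢ b j
  a≢b j = Pair.distinct (ends j)

  -- The two ends determine an edge of `G` as a set, and `edgeList` has no repetitions.
  simple : ∀ {i j v w} → Joins a b i v w → Joins a b j v w → i ≡ j
  simple {i} {j} {v} {w} Ji Jj = lookup-injective (edgeList-unique {E = E g}) (SubP.⊆-antisym (sub Ji Jj) (sub Jj Ji))
    where
    within : ∀ {i u} → Joins a b i v w → u ∈ₛ lookup es i → u ≡ v ⊎ u ≡ w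
    within {i} J u∈ with Pair.only (ends i) u∈ | J
    ... | inj₁ refl | inj₁ (refl , _) = inj₁ refl
    ... | inj₁ refl | inj₂ (_ , refl) = inj₂ refl
    ... | inj₂ refl | inj₁ (_ , refl) = inj₂ refl
    ... | inj₂ refl | inj₂ (refl , _) = inj₁ refl
    member : ∀ {i u} → Joins a b i v w → u ≡ v ⊎ u ≡ w → u ∈ₛ lookup es i
    member {i} (inj₁ (refl , refl)) (inj₁ refl) = Pair.fst∈ (ends i)
    member {i} (inj₁ (refl , refl)) (inj₂ refl) = Pair.snd∈ (ends i)
    member {i} (inj₂ (refl , refl)) (inj₁ refl) = Pair.snd∈ (ends i)
    member {i} (inj₂ (refl , refl)) (inj₂ refl) = Pair.fst∈ (ends i)
    sub : ∀ {i j} → Joins a b i v w → Joins a b j v w → ∀ {u} → u ∈ₛ lookup es i → u ∈ₛ lookup es j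
    sub Ji Jj u∈ = member Jj (within Ji u∈)

  old : Fin (N g) → Fin (N F)
  old v = v Fin.↑ˡ (m * (k ∸ 2))

  added : Fin m → Fin (k ∸ 2) → Fin (N F)
  added j i = N g Fin.↑ʳ Fin.combine j i

  data Vertex : Fin (N F) → Set where
    isOld : ∀ v → Vertex (old v)
    isAdded : ∀ j i → Vertex (added j i)

  vertexView : ∀ x → Vertex x
  vertexView x with Fin.splitAt (N g) x | FinP.join-splitAt (N g) (m * (k ∸ 2)) x
  ... | inj₁ v | refl = isOld v
  ... | inj₂ y | refl = subst (λ y → Vertex (N g Fin.↑ʳ y)) (FinP.combine-remQuot {m} (k ∸ 2) y) (isAdded _ _)

  opaque
    block : Fin m → Vec Bool (m * (k ∸ 2))
    block j = Vec.concat (Vec.tabulate (λ j′ → Vec.replicate (k ∸ 2) (j′ ==F j)))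

    hyperedge : Fin m → Subset (N F)
    hyperedge j = lookup es j Vec.++ block j

    hyperedge∈ : ∀ j → E F (hyperedge j) ≡ true
    hyperedge∈ j = anyL⁺ (λ j′ → hyperedge j ==S hyperedge j′) (MemP.∈-allFin j) (does-true⁺ (hyperedge j ≟S hyperedge j) refl)

    edge-hyperedge : ∀ {S} → E F S ≡ true → ∃ λ j → S ≡ hyperedge j
    edge-hyperedge {S} e with anyL⁻ (λ j → S ==S hyperedge j) (allFin m) e
    ... | j , _ , S≡ = j , does-true⁻ (S ≟S hyperedge j) S≡

    old∈⁺ : ∀ {j v} → v ∈ₛ lookup es j → old v ∈ₛ hyperedge j
    old∈⁺ {j} {v} v∈ = VecP.lookup⇒[]= _ _ (trans (VecP.lookup-++ˡ (lookup es j) (block j) v) (VecP.[]=⇒lookup v∈))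

    old∈⁻ : ∀ {j v} → old v ∈ₛ hyperedge j → v ∈ₛ lookup es j
    old∈⁻ {j} {v} v∈ = VecP.lookup⇒[]= v _ (trans (sym (VecP.lookup-++ˡ (lookup es j) (block j) v)) (VecP.[]=⇒lookup v∈))

    lookup-added : ∀ j j′ i → Vec.lookup (hyperedge j) (added j′ i) ≡ (j′ ==F j)
    lookup-added j j′ i = begin
      Vec.lookup (hyperedge j) (added j′ i) ≡⟨ VecP.lookup-++ʳ (lookup es j) (block j) (Fin.combine j′ i) ⟩
      Vec.lookup (block j) (Fin.combine j′ i) ≡⟨ VecP.lookup-concat (Vec.tabulate (λ j′ → Vec.replicate (k ∸ 2) (j′ ==F j))) j′ i ⟩
      Vec.lookup (Vec.lookup (Vec.tabulate (λ j′ → Vec.replicate (k ∸ 2) (j′ ==F j))) j′) i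
        ≡⟨ cong (λ v → Vec.lookup v i) (VecP.lookup∘tabulate (λ j′ → Vec.replicate (k ∸ 2) (j′ ==F j)) j′) ⟩
      Vec.lookup (Vec.replicate (k ∸ 2) (j′ ==F j)) i ≡⟨ VecP.lookup-replicate i (j′ ==F j) ⟩
      (j′ ==F j) ∎
      where open ≡-Reasoning

  added∈⁺ : ∀ j i → added j i ∈ₛ hyperedge j
  added∈⁺ j i = VecP.lookup⇒[]= _ _ (trans (lookup-added j j i) (does-true⁺ (j FinP.≟ j) refl))

  added∈⁻ : ∀ {j j′ i} → added j′ i ∈ₛ hyperedge j → j′ ≡ j
  added∈⁻ {j} {j′} {i} x∈ = does-true⁻ (j′ FinP.≟ j) (trans (sym (lookup-added j j′ i)) (VecP.[]=⇒lookup x∈))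

  module _ {n : ℕ} where

    embedding⇒copy : (φ : Vec (Fin n) (N F)) → Injection (Vec.lookup φ) → (∀ j → ∣ image φ (hyperedge j) ∣ ≡ k) →
      IsCopy k a b (λ v → Vec.lookup φ (old v)) (λ j → image φ (hyperedge j))
    embedding⇒copy φ φ-inj size = record
      { inj = λ eq → FinP.↑ˡ-injective (m * (k ∸ 2)) _ _ (φ-inj eq)
      ; left = λ j → ∈-image⁺ φ {hyperedge j} (old∈⁺ (Pair.fst∈ (ends j)))
      ; right = λ j → ∈-image⁺ φ {hyperedge j} (old∈⁺ (Pair.snd∈ (ends j)))
      ; core = λ j v v∈ → let x , x∈ , eq = ∈-image⁻ φ {hyperedge j} v∈
                          in Pair.only (ends j) (old∈⁻ (subst (_∈ₛ hyperedge j) (φ-inj eq) x∈))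
      ; meet = meet
      ; size = size
      }
      where
      meet : ∀ {i j z} → i ≢ j → z ∈ₛ image φ (hyperedge i) → z ∈ₛ image φ (hyperedge j) → ∃ λ v → z ≡ Vec.lookup φ (old v)
      meet {i} {j} i≢j z∈ z∈′ with ∈-image⁻ φ {hyperedge i} z∈ | ∈-image⁻ φ {hyperedge j} z∈′
      ... | x , x∈ , refl | x′ , x′∈ , eq with vertexView x
      ... | isOld v = v , refl
      ... | isAdded l r = contradiction (trans (sym (added∈⁻ x∈)) (added∈⁻ (subst (_∈ₛ hyperedge j) (φ-inj eq) x′∈))) i≢j

    module _ {c : Fin (N g) → Fin n} {h : Fin m → Subset n} (copy : IsCopy k a b c h) where
      open IsCopy copy

      private
        opaque
          rest : ∀ j → Enumeration (k ∸ 2) (remove (c (b j)) (remove (c (a j)) (h j)))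
          rest j = enumerateRest (size j) (a≢b j ∘ inj) (left j) (right j)

          new : Fin m → Fin (k ∸ 2) → Fin n
          new j = Enumeration.at (rest j)

          new∈ : ∀ j i → new j i ∈ₛ h j
          new∈ j i = proj₂ (∈-remove⁻ (proj₂ (∈-remove⁻ (Enumeration.at∈ (rest j) i))))

          new≢a : ∀ j i → new j i ≢ c (a j)
          new≢a j i = proj₁ (∈-remove⁻ (proj₂ (∈-remove⁻ (Enumeration.at∈ (rest j) i))))

          new≢b : ∀ j i → new j i ≢ c (b j)
          new≢b j i = proj₁ (∈-remove⁻ (Enumeration.at∈ (rest j) i))

          new-injʳ : ∀ j → Injection (new j)
          new-injʳ j = Enumeration.at-inj (rest j)

          new-onto : ∀ j {z} → z ∈ₛ h j → z ≢ c (a j) → z ≢ c (b j) → ∃ λ i → new j i ≡ z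
          new-onto j z∈ ≢a ≢b = Enumeration.onto (rest j) (∈-remove⁺ ≢b (∈-remove⁺ ≢a z∈))

        newAt : Fin (m * (k ∸ 2)) → Fin n
        newAt y = new (proj₁ (Fin.remQuot {m} (k ∸ 2) y)) (proj₂ (Fin.remQuot {m} (k ∸ 2) y))

      opaque
        -- Converse to `embedding⇒copy`: the `k - 2` vertices of `h j` beyond its core pair, in an
        -- arbitrary enumeration, become the images of block `j`.
        vertexMap : Vec (Fin n) (N F)
        vertexMap = Vec.tabulate λ x → [ c , newAt ]′ (Fin.splitAt (N g) x)

        map-old : ∀ v → Vec.lookup vertexMap (old v) ≡ c v
        map-old v = trans (VecP.lookup∘tabulate _ (old v)) (cong [ c , newAt ]′ (FinP.splitAt-↑ˡ (N g) v (m * (k ∸ 2))))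

        map-added : ∀ j i → Vec.lookup vertexMap (added j i) ≡ new j i
        map-added j i = trans (VecP.lookup∘tabulate _ (added j i))
          (trans (cong [ c , newAt ]′ (FinP.splitAt-↑ʳ (N g) (m * (k ∸ 2)) (Fin.combine j i)))
            (cong (λ ji → new (proj₁ ji) (proj₂ ji)) (FinP.remQuot-combine j i)))

      private
        new≢core : ∀ {j i v} → new j i ≢ c v
        new≢core {j} {i} {v} eq with core j v (subst (_∈ₛ h j) eq (new∈ j i))
        ... | inj₁ refl = new≢a j i eq
        ... | inj₂ refl = new≢b j i eq

        new-inj : ∀ {j i j′ i′} → new j i ≡ new j′ i′ → added j i ≡ added j′ i′
        new-inj {j} {i} {j′} {i′} eq with j FinP.≟ j′
        ... | yes refl = cong (added j) (new-injʳ j eq)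
        ... | no j≢j′ = contradiction (proj₂ (meet j≢j′ (new∈ j i) (subst (_∈ₛ h j′) (sym eq) (new∈ j′ i′)))) new≢core

      vertexMap-inj : Injection (Vec.lookup vertexMap)
      vertexMap-inj {x} {y} eq with vertexView x | vertexView y
      ... | isOld v | isOld w = cong old (inj (trans (sym (map-old v)) (trans eq (map-old w))))
      ... | isOld v | isAdded j i = contradiction (trans (sym (map-added j i)) (trans (sym eq) (map-old v))) new≢core
      ... | isAdded j i | isOld v = contradiction (trans (sym (map-added j i)) (trans eq (map-old v))) new≢core
      ... | isAdded j i | isAdded j′ i′ = new-inj (trans (sym (map-added j i)) (trans eq (map-added j′ i′)))

      image-hyperedge : ∀ j → image vertexMap (hyperedge j) ≡ h j
      image-hyperedge j = SubP.⊆-antisym to from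
        where
        old∈ : ∀ {v} → v ∈ₛ lookup es j → c v ∈ₛ h j
        old∈ v∈ with Pair.only (ends j) v∈
        ... | inj₁ refl = left j
        ... | inj₂ refl = right j
        to : ∀ {z} → z ∈ₛ image vertexMap (hyperedge j) → z ∈ₛ h j
        to z∈ with ∈-image⁻ vertexMap {hyperedge j} z∈
        ... | x , x∈ , refl with vertexView x
        ... | isOld v = subst (_∈ₛ h j) (sym (map-old v)) (old∈ (old∈⁻ x∈))
        ... | isAdded l i with added∈⁻ x∈
        ... | refl = subst (_∈ₛ h j) (sym (map-added j i)) (new∈ j i)
        from : ∀ {z} → z ∈ₛ h j → z ∈ₛ image vertexMap (hyperedge j)
        from {z} z∈ with z FinP.≟ c (a j) | z FinP.≟ c (b j)
        ... | yes refl | _ = subst (_∈ₛ image vertexMap (hyperedge j)) (map-old (a j)) (∈-image⁺ vertexMap {hyperedge j} (old∈⁺ (Pair.fst∈ (ends j))))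
        ... | no _ | yes refl = subst (_∈ₛ image vertexMap (hyperedge j)) (map-old (b j)) (∈-image⁺ vertexMap {hyperedge j} (old∈⁺ (Pair.snd∈ (ends j))))
        ... | no ≢a | no ≢b with new-onto j z∈ ≢a ≢b
        ... | i , refl = subst (_∈ₛ image vertexMap (hyperedge j)) (map-added j i) (∈-image⁺ vertexMap {hyperedge j} (added∈⁺ j i))

  -- The process and its running time

  module Run (n : ℕ) (EH : Subset n → Bool) (uniform : Uniform k (hg n EH)) where

    P : ℕ → Subset n → Bool
    P = process k F EH

    H : ℕ → Subset n → Set
    H t f = P t f ≡ true

    mono : ∀ {t f} → H t f → H (suc t) f
    mono = ∨-true⁺ˡ

    size : ∀ t {f} → H t f → ∣ f ∣ ≡ k
    size zero = uniform _
    size (suc t) {f} Hf with ∨-true⁻ {P t f} Hf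
    ... | inj₁ old = size t old
    ... | inj₂ new = ℕP.≡ᵇ⇒≡ _ _ (Equivalence.from BoolP.T-≡ (proj₁ (∧-true⁻ {∣ f ∣ ≡ᵇ k} new)))

    complete : ∀ {t c h} j → IsCopy k a b c h → (∀ i → i ≢ j → H t (h i)) → H (suc t) (h j)
    complete {t} {c} {h} j copy Hh with P t (h j) in eq
    ... | true = refl
    ... | false = ∧-true⁺ (Equivalence.to BoolP.T-≡ (ℕP.≡⇒≡ᵇ _ _ (IsCopy.size copy j)))
          (Equivalence.to BoolP.T-≡ (ℕP.<⇒<ᵇ (copies⁺ F (P t) (h j) eq record
            { φ = vertexMap copy
            ; φ-inj = vertexMap-inj copy
            ; maps = λ {S} → maps {S}
            ; source = hyperedge j
            ; source∈ = hyperedge∈ j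
            ; hits = image-hyperedge copy j })))
      where
      maps : ∀ {S} → E F S ≡ true → addEdge (P t) (h j) (image (vertexMap copy) S) ≡ true
      maps {S} S∈ with edge-hyperedge {S} S∈
      ... | i , refl with i FinP.≟ j
      ... | yes refl = ∨-true⁺ʳ {P t (image (vertexMap copy) S)} (does-true⁺ (image (vertexMap copy) S ≟S h j) (image-hyperedge copy i))
      ... | no i≢j = ∨-true⁺ˡ (subst (H t) (sym (image-hyperedge copy i)) (Hh i i≢j))

    New : ℕ → Set
    New t = ∃ λ f → P t f ≡ false × H (suc t) f

    newEdge : ∀ {t} → New t → NewEdge k a b H t
    newEdge {t} (f , f∉ , f∈) with ∨-true⁻ {P t f} f∈
    ... | inj₁ old = contradiction (trans (sym f∉) old) λ ()
    ... | inj₂ new with copies⁻ F (P t) f f∉ (ℕP.<ᵇ⇒< _ _ (Equivalence.from BoolP.T-≡ (proj₂ (∧-true⁻ {∣ f ∣ ≡ᵇ k} new))))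
    ... | emb with edge-hyperedge {Embedding.source emb} (Embedding.source∈ emb)
    ... | j , source≡ = record
      { vertex = λ v → Vec.lookup φ (old v)
      ; edge = λ i → image φ (hyperedge i)
      ; isCopy = embedding⇒copy φ φ-inj (λ i → size (suc t) (built i))
      ; label = j
      ; absent = λ Hf → contradiction (trans (sym f∉) (subst (H t) hits′ Hf)) λ ()
      ; built = built
      }
      where
      open Embedding emb
      hits′ : image φ (hyperedge j) ≡ f
      hits′ = trans (cong (image φ) (sym source≡)) hits
      built : ∀ i → H (suc t) (image φ (hyperedge i))
      built i with ∨-true⁻ {P t (image φ (hyperedge i))} (maps {hyperedge i} (hyperedge∈ i))
      ... | inj₁ Hi = mono {t} Hi
      ... | inj₂ e = subst (H (suc t)) (sym (does-true⁻ (image φ (hyperedge i) ≟S f) e)) f∈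

    stable⊎new : ∀ t → (∀ S → P t S ≡ P (suc t) S) ⊎ New t
    stable⊎new t with SubP.anySubset? (λ S → (P t S BoolP.≟ false) ×-dec (P (suc t) S BoolP.≟ true))
    ... | yes new = inj₂ new
    ... | no none = inj₁ unchanged
      where
      unchanged : ∀ S → P t S ≡ P (suc t) S
      unchanged S = monotone-≡ (mono {t}) λ (f∉ , f∈) → none (S , f∉ , f∈)

    stabilises : ∀ C → ¬ (∀ t → t ≤ C → New t) → RunningTimeAtMost k F (hg n EH) C
    stabilises C ¬always with search (suc C)
      where
      search : ∀ r → (∃ λ t → t < r × (∀ S → P t S ≡ P (suc t) S)) ⊎ (∀ t → t < r → New t)
      search zero = inj₂ λ _ ()
      search (suc r) with search r | stable⊎new r
      ... | inj₁ (t , t<r , st) | _ = inj₁ (t , ℕP.m<n⇒m<1+n t<r , st)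
      ... | inj₂ _ | inj₁ st = inj₁ (r , ≤-refl , st)
      ... | inj₂ always | inj₂ new = inj₂ λ t t<sr → case ℕP.m<1+n⇒m<n∨m≡n t<sr of λ { (inj₁ t<r) → always t t<r ; (inj₂ refl) → new }
    ... | inj₁ (t , s≤s t≤C , st) = t , t≤C , st
    ... | inj₂ always = contradiction (λ t t≤C → always t (s≤s t≤C)) ¬always

    mono-≤ : ∀ {s t f} → s ≤ t → H s f → H t f
    mono-≤ = stepwise-mono H (λ t → mono {t})

    -- Each step supplies a set that is absent before it and present ever after, so the sets of
    -- different steps differ; `suc C` steps would need more than `2 ^ n` subsets.
    few : ∀ {C} → 2 ^ n ≤ C → ¬ (∀ t → t ≤ C → New t)
    few {C} 2^n≤C always = contradiction (FinP.injective⇒≤ {f = index} index-inj)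
      (ℕP.<⇒≱ (s≤s (≤-trans (≤-reflexive (length-allSubsets n)) 2^n≤C)))
      where
      new : (i : Fin (suc C)) → New (toℕ i)
      new i = always (toℕ i) (≤-pred (FinP.toℕ<n i))
      edge : Fin (suc C) → Subset n
      edge i = proj₁ (new i)
      index : Fin (suc C) → Fin (length (allSubsets n))
      index i = Any.index (∈-allSubsets (edge i))
      increasing : ∀ {i j} → i Fin.< j → edge i ≢ edge j
      increasing {i} {j} i<j eq = contradiction
        (trans (sym (mono-≤ i<j (subst (H (suc (toℕ i))) eq (proj₂ (proj₂ (new i)))))) (proj₁ (proj₂ (new j)))) λ ()
      edge-inj : Injection edge
      edge-inj {i} {j} eq with FinP.<-cmp i j
      ... | tri< i<j _ _ = contradiction eq (increasing i<j)
      ... | tri≈ _ i≡j _ = i≡j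
      ... | tri> _ _ j<i = contradiction (sym eq) (increasing j<i)
      index-inj : Injection index
      index-inj {i} {j} eq = edge-inj (trans (AnyP.lookup-index (∈-allSubsets (edge i)))
        (trans (cong (lookup (allSubsets n)) eq) (sym (AnyP.lookup-index (∈-allSubsets (edge j))))))

    open Constants k (N g) m

    -- The summand `2 ^ minVertices` handles the vertex sets too small for the combinatorial
    -- argument, by the trivial bound.
    bounded : RunningTimeAtMost k F (hg n EH) (runningTime + 2 ^ minVertices)
    bounded with minVertices ≤? n
    ... | no n≱ = stabilises _ (few (≤-trans (ℕP.^-monoʳ-≤ 2 (ℕP.<⇒≤ (ℕP.≰⇒> n≱))) (ℕP.m≤n+m _ runningTime)))
    ... | yes large = stabilises _ λ always →
          Combinatorics.notAlwaysNew a b a≢b simple 3≤k H (λ {t} → mono {t}) (λ {t} → complete {t}) large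
            (λ t t≤ → newEdge {t} (always t (≤-trans t≤ (ℕP.m≤m+n runningTime _))))

theorem1p1 : (k : ℕ) → k ≥ 3 → (G : Graph) →
    ∃[ C ] ((n : ℕ) → (EH : Subset n → Bool) → Uniform k (hg n EH) →
    RunningTimeAtMost k (extension k (proj₁ G)) (hg n EH) C)
theorem1p1 k 3≤k G = _ , λ n EH uniform → Extension.Run.bounded k 3≤k G n EH uniform
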